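{- Let $q$ be an odd prime power and let $d\ge 3$ be odd. For every $\varepsilon>0$ there exists $c>0$ such that the following holds: if $\mathcal{P}\subseteq \mathbb{F}_q^d$ satisfies $|\mathcal{P}|\ge (1+\varepsilon)q^{(d+1)/2}$, then the number of distinct spreads determined by $\mathcal{P}$ is at least $cq$.
   Context: For $\mathbf{u},\mathbf{v}\in\mathbb{F}_q^d$, $\mathbf{u}\cdot\mathbf{v}=\sum_{i=1}^d u_iv_i$ and $\|\mathbf{x}\|=\mathbf{x}\cdot\mathbf{x}$. For points $\mathbf{a},\mathbf{b},\mathbf{c}\in\mathbb{F}_q^d$, the spread $S(\mathbf{b},\mathbf{a},\mathbf{c})$ is $$S(\mathbf{b},\mathbf{a},\mathbf{c})=1-\frac{((\mathbf{b}-\mathbf{a})\cdot(\mathbf{c}-\mathbf{a}))^2}{\|\mathbf{b}-\mathbf{a}\|\,\|\mathbf{c}-\mathbf{a}\|},$$ undefined if either factor in the denominator is $0$. The spreads determined by $\mathcal{P}$ are the values $S(\mathbf{b},\mathbf{a},\mathbf{c})$ over all $\mathbf{a},\mathbf{b},\mathbf{c}\in\mathcal{P}$ for which it is defined. The paper assumes throughout that $q$ is a large odd prime power. -}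

module Defs where

open import Level using (0ℓ)
open import Data.Nat as ℕ using (ℕ; _^_; _%_)
open import Data.Nat.Primality using (Prime)
open import Data.Product using (Σ; _×_; _,_)
open import Data.List using (List; []; _∷_; length; concatMap; deduplicate)
open import Data.List.Relation.Unary.Unique.Propositional using (Unique)
open import Data.List.Membership.Propositional using (_∈_)
open import Data.Vec using (Vec; zipWith; foldr′)
open import Data.Fin as Fin using (Fin)
open import Relation.Binary.PropositionalEquality using (_≡_; _≢_)
open import Relation.Binary.Definitions using (DecidableEquality)
open import Relation.Nullary using (yes; no)
import Algebra.Structures as AS

record FiniteField : Set₁ where
  infixl 6 _+_ _-_
  infixl 7 _*_
  field
    F     : Set
    _+_   : F → F → F
    _*_   : F → F → F
    -_    : F → F
    0#    : F
    1#    : F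
    _⁻¹   : F → F
    isCommutativeRing : AS.IsCommutativeRing {A = F} _≡_ _+_ _*_ -_ 0# 1#
    0≢1   : 0# ≢ 1#
    ⁻¹-inverse : ∀ x → x ≢ 0# → x * (x ⁻¹) ≡ 1#
    _≟_   : DecidableEquality F
    elements : List F
    elements-unique : Unique elements
    elements-complete : ∀ x → x ∈ elements

  _-_ : F → F → F
  x - y = x + (- y)

  order : ℕ
  order = length elements

  Point : ℕ → Set
  Point d = Vec F d

  dot : ∀ {d} → Point d → Point d → F
  dot u v = foldr′ _+_ 0# (zipWith _*_ u v)

  norm : ∀ {d} → Point d → F
  norm x = dot x x

  sub : ∀ {d} → Point d → Point d → Point d
  sub u v = zipWith _-_ u v

  -- S(b,a,c) = 1 - ((b-a)·(c-a))² / (‖b-a‖ ‖c-a‖), only used when defined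
  spreadValue : ∀ {d} → Point d → Point d → Point d → F
  spreadValue b a c =
    1# - (dot (sub b a) (sub c a) * dot (sub b a) (sub c a))
         * ((norm (sub b a) * norm (sub c a)) ⁻¹)

  spreadsWithDup : ∀ {d} → List (Point d) → List F
  spreadsWithDup P =
    concatMap (λ a → concatMap (λ b → concatMap (λ c → entry a b c) P) P) P
    where
    entry : _ → _ → _ → List F
    entry a b c with norm (sub b a) ≟ 0# | norm (sub c a) ≟ 0#
    ... | no _ | no _ = spreadValue b a c ∷ []
    ... | _    | _    = []

  numSpreads : ∀ {d} → List (Point d) → ℕ
  numSpreads P = length (deduplicate _≟_ (spreadsWithDup P))

IsPrimePower : ℕ → Set
IsPrimePower q = Σ ℕ λ p → Σ ℕ λ k → Prime p × q ≡ p ^ ℕ.suc k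

{-# OPTIONS --safe #-}
module Submission where

-- Write k = (d+1)/2 and Q = q^k. Restrict P to at most 2Q points. Every linear map
-- A : F^d → F^k has Q fibres, so at least |P| - Q points of P share their fibre with another
-- point, i.e. A kills one of the directions issuing from such a point. As a given direction is
-- killed by a fraction 1/Q of all A, averaging over A shows that on average a point of P sees
-- a constant times Q directions in P; it is here that the factor 1 + ε is used.
-- Few of them are isotropic: lifting x to (‖x‖, x) turns ‖b - a‖ = 0 into a point-hyperplane
-- incidence in F^(d+1), and the second moment bound for incidences gives at most about
-- |P|²/q + q^(d/2)|P| isotropic pairs. Scale the remaining directions at a ∈ P to a common
-- norm r ≠ 0. The same second moment bound in F^d shows that no value of the dot product is
-- taken much more often than average on the resulting set, so that there are at least
-- a constant times q dot products t, and t ↦ 1 - t²/r² is at most two-to-one.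

open import Defs

-- The second moment bound for dot products takes effect on sets of size about q^((d+1)/2), which is
-- exactly the number Q of fibres: slightly more than Q points are enough for a typical point to see
-- a positive proportion of Q directions. Scaling has an obstruction: multiples of v only reach
-- norms in the square class of ‖v‖. So all r ≠ 0 are used together: the q - 1 nonzero multiples of
-- a non-isotropic v lie on exactly one sphere each, and every direction gets the same weight q - 1.
-- The estimate for one vertex and one norm is affine in the size of the sphere, hence can be summed
-- over all a and r, and no rich vertex or norm has to be selected. The cap 2Q keeps the isotropic
-- pairs below the order Q² and the error term Q|P| of order Q². If n is the denominator of ε, then
-- |P| ≥ (1 + 1/n)Q gives at least Q²/n directions over all vertices, isotropic pairs included, and
-- the latter take at most half of them once q ≥ 16n(n + 1). For smaller q one spread is enough, at
-- the price of a smaller c. As d is odd, q^(d+1) = Q² has an integral root, which serves as the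
-- AM-GM parameter.

-- Finite sums of natural numbers, indicators and double counting.

module Sums where

  open import Data.Nat
  open import Data.Nat.Properties
  open import Data.Nat.Tactic.RingSolver using (solve-∀)
  open import Data.Product using (∃; _,_)
  open import Data.Sum using (_⊎_; inj₁; inj₂)
  open import Data.Empty using (⊥-elim)
  open import Data.List using (List; []; _∷_; _++_; length; map; filter; cartesianProductWith)
  open import Data.List.Membership.Propositional using (_∈_)
  open import Data.List.Membership.Propositional.Properties using (∈-∃++; ∈-++⁻; ∈-++⁺ˡ; ∈-++⁺ʳ)
  open import Data.List.Relation.Unary.Any using (here; there)
  open import Data.List.Relation.Unary.All using (lookup)
  open import Data.List.Relation.Unary.AllPairs using ([]; _∷_)
  open import Data.List.Relation.Unary.Unique.Propositional using (Unique)
  open import Data.List.Relation.Unary.Unique.Propositional.Properties using (map⁺)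
  open import Relation.Nullary using (Dec; yes; no; ¬_)
  open import Relation.Nullary.Decidable using (_×-dec_)
  open import Relation.Binary.PropositionalEquality
  open import Function using (_∘_)

  private variable
    A B C : Set
    P R : Set

  ∑ : List A → (A → ℕ) → ℕ
  ∑ []       f = 0
  ∑ (x ∷ xs) f = f x + ∑ xs f

  infix 5 ∑
  syntax ∑ xs (λ x → e) = ∑[ x ← xs ] e

  𝟙 : Dec P → ℕ
  𝟙 (yes _) = 1
  𝟙 (no _)  = 0

  ∑-cong : ∀ {f g : A → ℕ} xs → (∀ x → x ∈ xs → f x ≡ g x) → ∑ xs f ≡ ∑ xs g
  ∑-cong []       h = refl
  ∑-cong (x ∷ xs) h = cong₂ _+_ (h x (here refl)) (∑-cong xs λ y → h y ∘ there)

  ∑-mono : ∀ {f g : A → ℕ} xs → (∀ x → x ∈ xs → f x ≤ g x) → ∑ xs f ≤ ∑ xs g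
  ∑-mono []       h = z≤n
  ∑-mono (x ∷ xs) h = +-mono-≤ (h x (here refl)) (∑-mono xs λ y → h y ∘ there)

  ∑-const : ∀ (xs : List A) c → ∑ xs (λ _ → c) ≡ length xs * c
  ∑-const []       c = refl
  ∑-const (x ∷ xs) c = cong (c +_) (∑-const xs c)

  ∑-zero : ∀ (xs : List A) → ∑ xs (λ _ → 0) ≡ 0
  ∑-zero xs = trans (∑-const xs 0) (*-zeroʳ (length xs))

  ∑-+ : ∀ (xs : List A) f g → ∑ xs (λ x → f x + g x) ≡ ∑ xs f + ∑ xs g
  ∑-+ []       f g = refl
  ∑-+ (x ∷ xs) f g rewrite ∑-+ xs f g = lemma (f x) (g x) (∑ xs f) (∑ xs g)
    where
    lemma : ∀ a b c d → (a + b) + (c + d) ≡ (a + c) + (b + d)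
    lemma = solve-∀

  ∑-*ˡ : ∀ (xs : List A) c f → ∑ xs (λ x → c * f x) ≡ c * ∑ xs f
  ∑-*ˡ []       c f = sym (*-zeroʳ c)
  ∑-*ˡ (x ∷ xs) c f rewrite ∑-*ˡ xs c f = sym (*-distribˡ-+ c (f x) (∑ xs f))

  ∑-*ʳ : ∀ (xs : List A) c f → ∑ xs (λ x → f x * c) ≡ ∑ xs f * c
  ∑-*ʳ []       c f = refl
  ∑-*ʳ (x ∷ xs) c f rewrite ∑-*ʳ xs c f = sym (*-distribʳ-+ c (f x) (∑ xs f))

  ∑-swap : ∀ (xs : List A) (ys : List B) (f : A → B → ℕ) →
           ∑[ x ← xs ] ∑[ y ← ys ] f x y ≡ ∑[ y ← ys ] ∑[ x ← xs ] f x y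
  ∑-swap []       ys f = sym (∑-zero ys)
  ∑-swap (x ∷ xs) ys f rewrite ∑-swap xs ys f = sym (∑-+ ys (f x) λ y → ∑ xs λ z → f z y)

  ∑-++ : ∀ (xs ys : List A) f → ∑ (xs ++ ys) f ≡ ∑ xs f + ∑ ys f
  ∑-++ []       ys f = refl
  ∑-++ (x ∷ xs) ys f rewrite ∑-++ xs ys f = sym (+-assoc (f x) (∑ xs f) (∑ ys f))

  ∑-map : ∀ (g : A → B) xs f → ∑ (map g xs) f ≡ ∑ xs (f ∘ g)
  ∑-map g []       f = refl
  ∑-map g (x ∷ xs) f = cong (f (g x) +_) (∑-map g xs f)

  ∑-cartesianProductWith : ∀ (g : A → B → C) xs ys f →
    ∑ (cartesianProductWith g xs ys) f ≡ ∑[ x ← xs ] ∑[ y ← ys ] f (g x y)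
  ∑-cartesianProductWith g []       ys f = refl
  ∑-cartesianProductWith g (x ∷ xs) ys f =
    trans (∑-++ (map (g x) ys) _ f)
          (cong₂ _+_ (∑-map (g x) ys f) (∑-cartesianProductWith g xs ys f))

  ∑-filter : ∀ {P : A → Set} (P? : ∀ x → Dec (P x)) xs f →
             ∑ (filter P? xs) f ≡ ∑[ x ← xs ] 𝟙 (P? x) * f x
  ∑-filter P? []       f = refl
  ∑-filter P? (x ∷ xs) f with P? x
  ... | yes _ = cong₂ _+_ (sym (*-identityˡ (f x))) (∑-filter P? xs f)
  ... | no  _ = ∑-filter P? xs f

  length-∑ : ∀ (xs : List A) → length xs ≡ ∑ xs (λ _ → 1)
  length-∑ xs = sym (trans (∑-const xs 1) (*-identityʳ (length xs)))

  length-filter-∑ : ∀ {P : A → Set} (P? : ∀ x → Dec (P x)) xs →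
                    length (filter P? xs) ≡ ∑[ x ← xs ] 𝟙 (P? x)
  length-filter-∑ P? xs = trans (length-∑ (filter P? xs))
    (trans (∑-filter P? xs λ _ → 1) (∑-cong xs λ x _ → *-identityʳ (𝟙 (P? x))))

  ∑-⊆ : ∀ {xs ys : List A} f → Unique xs → (∀ {x} → x ∈ xs → x ∈ ys) → ∑ xs f ≤ ∑ ys f
  ∑-⊆ {xs = []}     f []       sub = z≤n
  ∑-⊆ {xs = x ∷ xs} f (x∉ ∷ u) sub with ∈-∃++ (sub (here refl))
  ... | as , bs , refl = begin
    f x + ∑ xs f               ≤⟨ +-monoʳ-≤ (f x) (∑-⊆ f u sub′) ⟩
    f x + ∑ (as ++ bs) f       ≡⟨ cong (f x +_) (∑-++ as bs f) ⟩
    f x + (∑ as f + ∑ bs f)    ≡⟨ lemma (f x) (∑ as f) (∑ bs f) ⟩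
    ∑ as f + (f x + ∑ bs f)    ≡⟨ ∑-++ as (x ∷ bs) f ⟨
    ∑ (as ++ x ∷ bs) f         ∎
    where
    open ≤-Reasoning
    lemma : ∀ a b c → a + (b + c) ≡ b + (a + c)
    lemma = solve-∀
    sub′ : ∀ {y} → y ∈ xs → y ∈ as ++ bs
    sub′ {y} y∈ with ∈-++⁻ as (sub (there y∈))
    ... | inj₁ y∈as           = ∈-++⁺ˡ y∈as
    ... | inj₂ (here refl)    = ⊥-elim (lookup x∉ y∈ refl)
    ... | inj₂ (there y∈bs)   = ∈-++⁺ʳ as y∈bs

  length-⊆ : ∀ {xs ys : List A} → Unique xs → (∀ {x} → x ∈ xs → x ∈ ys) → length xs ≤ length ys
  length-⊆ {xs = xs} {ys} u sub =
    subst₂ _≤_ (sym (length-∑ xs)) (sym (length-∑ ys)) (∑-⊆ (λ _ → 1) u sub)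

  ∑-∈ : ∀ {xs : List A} {x} f → x ∈ xs → f x ≤ ∑ xs f
  ∑-∈ {xs = x ∷ xs} f (here refl) = m≤m+n (f x) (∑ xs f)
  ∑-∈ {xs = x ∷ xs} f (there x∈)  = ≤-trans (∑-∈ f x∈) (m≤n+m (∑ xs f) (f x))

  ∑-injection : ∀ {xs : List A} {ys : List B} {g : A → B} f →
                (∀ {x y} → g x ≡ g y → x ≡ y) → Unique xs → (∀ y → y ∈ ys) →
                ∑ xs (f ∘ g) ≤ ∑ ys f
  ∑-injection {xs = xs} {g = g} f inj u all =
    ≤-trans (≤-reflexive (sym (∑-map g xs f))) (∑-⊆ f (map⁺ inj u) λ _ → all _)

  ∑-bijection : ∀ {xs : List A} (g h : A → A) f → (∀ x → h (g x) ≡ x) → (∀ x → g (h x) ≡ x) →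
                Unique xs → (∀ x → x ∈ xs) → ∑ xs (f ∘ g) ≡ ∑ xs f
  ∑-bijection {xs = xs} g h f hg gh u all = ≤-antisym
    (∑-injection f (λ {x} {y} e → trans (sym (hg x)) (trans (cong h e) (hg y))) u all)
    (≤-trans (≤-reflexive (∑-cong xs λ x _ → cong f (sym (gh x))))
      (∑-injection {g = h} (f ∘ g) (λ {x} {y} e → trans (sym (gh x)) (trans (cong g e) (gh y))) u all))

  𝟙≤1 : (d : Dec P) → 𝟙 d ≤ 1
  𝟙≤1 (yes _) = ≤-refl
  𝟙≤1 (no _)  = z≤n

  𝟙-yes : (d : Dec P) → P → 𝟙 d ≡ 1
  𝟙-yes (yes _) p = refl
  𝟙-yes (no ¬p) p = ⊥-elim (¬p p)

  𝟙-no : (d : Dec P) → ¬ P → 𝟙 d ≡ 0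
  𝟙-no (yes p) ¬p = ⊥-elim (¬p p)
  𝟙-no (no _)  ¬p = refl

  𝟙-≤ : (d : Dec P) {n : ℕ} → (P → 1 ≤ n) → 𝟙 d ≤ n
  𝟙-≤ (yes p) h = h p
  𝟙-≤ (no _)  h = z≤n

  𝟙-mono : (d : Dec P) (e : Dec R) → (P → R) → 𝟙 d ≤ 𝟙 e
  𝟙-mono d e h = 𝟙-≤ d λ p → ≤-reflexive (sym (𝟙-yes e (h p)))

  𝟙-cong : (d : Dec P) (e : Dec R) → (P → R) → (R → P) → 𝟙 d ≡ 𝟙 e
  𝟙-cong d e h k = ≤-antisym (𝟙-mono d e h) (𝟙-mono e d k)

  𝟙-× : (d : Dec P) (e : Dec R) → 𝟙 (d ×-dec e) ≡ 𝟙 d * 𝟙 e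
  𝟙-× (yes _) (yes _) = refl
  𝟙-× (yes _) (no _)  = refl
  𝟙-× (no _)  e       = refl

  ∑-atMost1 : ∀ {P : A → Set} (P? : ∀ x → Dec (P x)) {xs} → Unique xs →
              (∀ {x y} → x ∈ xs → y ∈ xs → P x → P y → x ≡ y) → ∑[ x ← xs ] 𝟙 (P? x) ≤ 1
  ∑-atMost1 P? {[]}     []       h = z≤n
  ∑-atMost1 P? {x ∷ xs} (x∉ ∷ u) h with P? x
  ... | no _  = ∑-atMost1 P? u λ x∈ y∈ → h (there x∈) (there y∈)
  ... | yes p = s≤s (≤-trans (∑-mono xs λ y y∈ → ≤-reflexive (𝟙-no (P? y) λ q →
                  lookup x∉ y∈ (h (here refl) (there y∈) p q))) (≤-reflexive (∑-zero xs)))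

  ∑-exactly1 : ∀ {P : A → Set} (P? : ∀ x → Dec (P x)) {xs} → Unique xs →
               ∀ {x} → x ∈ xs → P x → (∀ {y} → P y → y ≡ x) → ∑[ x ← xs ] 𝟙 (P? x) ≡ 1
  ∑-exactly1 P? u {x} x∈ p h = ≤-antisym
    (∑-atMost1 P? u λ _ _ p q → trans (h p) (sym (h q)))
    (≤-trans (≤-reflexive (sym (𝟙-yes (P? x) p))) (∑-∈ (λ x → 𝟙 (P? x)) x∈))

  ∑-square : ∀ (xs : List A) f → ∑ xs f * ∑ xs f ≡ ∑[ x ← xs ] ∑[ y ← xs ] f x * f y
  ∑-square xs f = trans (sym (∑-*ʳ xs (∑ xs f) f)) (∑-cong xs λ x _ → sym (∑-*ˡ xs (f x) f))

  -- The handshake argument: entries off the diagonal come in equal pairs. With `g` the indicator of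
  -- a fixed-point-free involution it shows that the underlying set has even size.
  ∑-symmetric-even : ∀ (xs : List A) (g : A → A → ℕ) → (∀ x → g x x ≡ 0) → (∀ x y → g x y ≡ g y x) →
                     ∃ λ k → ∑[ x ← xs ] ∑[ y ← xs ] g x y ≡ 2 * k
  ∑-symmetric-even []       g diag symm = 0 , refl
  ∑-symmetric-even (x ∷ xs) g diag symm with ∑-symmetric-even xs g diag symm
  ... | k , e = ∑ xs (g x) + k , (begin
    (g x x + ∑ xs (g x)) + (∑[ z ← xs ] (g z x + ∑ xs (g z)))
      ≡⟨ cong₂ (λ a b → a + ∑ xs (g x) + b) (diag x) (∑-+ xs (λ z → g z x) (λ z → ∑ xs (g z))) ⟩
    ∑ xs (g x) + ((∑[ z ← xs ] g z x) + (∑[ z ← xs ] ∑ xs (g z)))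
      ≡⟨ cong₂ (λ a b → ∑ xs (g x) + (a + b)) (∑-cong xs λ z _ → symm z x) e ⟩
    ∑ xs (g x) + (∑ xs (g x) + 2 * k)
      ≡⟨ lemma (∑ xs (g x)) k ⟩
    2 * (∑ xs (g x) + k) ∎)
    where
    open ≡-Reasoning
    lemma : ∀ a k → a + (a + 2 * k) ≡ 2 * (a + k)
    lemma = solve-∀

  ∑-atMost2 : ∀ (_≟_ : (x y : A) → Dec (x ≡ y)) {P : A → Set} (P? : ∀ x → Dec (P x)) {xs} → Unique xs →
              ∀ y z → (∀ {x} → x ∈ xs → P x → x ≡ y ⊎ x ≡ z) → ∑[ x ← xs ] 𝟙 (P? x) ≤ 2
  ∑-atMost2 _≟_ {P} P? {xs} u y z h = begin
    (∑[ x ← xs ] 𝟙 (P? x))                              ≤⟨ ∑-mono xs (λ x x∈ → 𝟙-≤ (P? x) (λ p → either x (h x∈ p))) ⟩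
    (∑[ x ← xs ] (𝟙 (x ≟ y) + 𝟙 (x ≟ z)))               ≡⟨ ∑-+ xs _ _ ⟩
    (∑[ x ← xs ] 𝟙 (x ≟ y)) + (∑[ x ← xs ] 𝟙 (x ≟ z))   ≤⟨ +-mono-≤ (once y) (once z) ⟩
    2                                                   ∎
    where
    open ≤-Reasoning
    once : ∀ y → ∑[ x ← xs ] 𝟙 (x ≟ y) ≤ 1
    once y = ∑-atMost1 (_≟ y) u λ _ _ p q → trans p (sym q)
    either : ∀ x → x ≡ y ⊎ x ≡ z → 1 ≤ 𝟙 (x ≟ y) + 𝟙 (x ≟ z)
    either x (inj₁ e) = m≤n⇒m≤n+o _ (≤-reflexive (sym (𝟙-yes (x ≟ y) e)))
    either x (inj₂ e) = m≤n⇒m≤o+n (𝟙 (x ≟ y)) (≤-reflexive (sym (𝟙-yes (x ≟ z) e)))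

-- The second moment method for abstract incidences.

module SecondMoment where

  open Sums
  open import Data.Nat
  open import Data.Nat.Properties
  open import Data.Nat.Tactic.RingSolver using (solve-∀)
  open import Data.List using (List; length)
  open import Data.List.Membership.Propositional using (_∈_)
  open import Data.List.Relation.Unary.Unique.Propositional using (Unique)
  open import Relation.Binary.PropositionalEquality

  private variable
    A I : Set

  ∣-∣²+2ab≡a²+b² : ∀ a b → ∣ a - b ∣ * ∣ a - b ∣ + 2 * (a * b) ≡ a * a + b * b
  ∣-∣²+2ab≡a²+b² zero    b       = +-identityʳ (b * b)
  ∣-∣²+2ab≡a²+b² (suc a) zero    = trans (cong (λ z → suc a * suc a + 2 * z) (*-zeroʳ (suc a))) refl
  ∣-∣²+2ab≡a²+b² (suc a) (suc b) = begin
    ∣ a - b ∣ * ∣ a - b ∣ + 2 * (suc a * suc b)              ≡⟨ split (∣ a - b ∣ * ∣ a - b ∣) a b ⟩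
    ∣ a - b ∣ * ∣ a - b ∣ + 2 * (a * b) + 2 * (1 + a + b)    ≡⟨ cong (_+ 2 * (1 + a + b)) (∣-∣²+2ab≡a²+b² a b) ⟩
    a * a + b * b + 2 * (1 + a + b)                          ≡⟨ join a b ⟩
    suc a * suc a + suc b * suc b                            ∎
    where
    open ≡-Reasoning
    split : ∀ x a b → x + 2 * (suc a * suc b) ≡ x + 2 * (a * b) + 2 * (1 + a + b)
    split = solve-∀
    join : ∀ a b → a * a + b * b + 2 * (1 + a + b) ≡ suc a * suc a + suc b * suc b
    join = solve-∀

  2ab≤a²+b² : ∀ a b → 2 * (a * b) ≤ a * a + b * b
  2ab≤a²+b² a b = subst (2 * (a * b) ≤_) (∣-∣²+2ab≡a²+b² a b) (m≤n+m (2 * (a * b)) (∣ a - b ∣ * ∣ a - b ∣))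

  -- A linearised Cauchy-Schwarz inequality: the excess of `a` over `m` is at most the deviation,
  -- and AM-GM trades it for its square. It is sharp when `t` is the typical size of the deviation.
  2ta≤2tm+t²+∣a-m∣² : ∀ t a m → 2 * t * a ≤ (2 * t * m + t * t) + ∣ a - m ∣ * ∣ a - m ∣
  2ta≤2tm+t²+∣a-m∣² t a m = begin
    2 * t * a                                          ≤⟨ *-monoʳ-≤ (2 * t) (m≤n+∣m-n∣ a m) ⟩
    2 * t * (m + ∣ a - m ∣)                            ≡⟨ split t m ∣ a - m ∣ ⟩
    2 * t * m + 2 * (t * ∣ a - m ∣)                    ≤⟨ +-monoʳ-≤ (2 * t * m) (2ab≤a²+b² t ∣ a - m ∣) ⟩
    2 * t * m + (t * t + ∣ a - m ∣ * ∣ a - m ∣)        ≡⟨ +-assoc (2 * t * m) (t * t) _ ⟨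
    (2 * t * m + t * t) + ∣ a - m ∣ * ∣ a - m ∣        ∎
    where
    open ≤-Reasoning
    split : ∀ t m d → 2 * t * (m + d) ≡ 2 * t * m + 2 * (t * d)
    split = solve-∀

  -- Expanding the variance over all of X bounds its part over E; AM-GM with the free
  -- parameter t replaces Cauchy–Schwarz, so that no square root is needed.
  incidence-bound : ∀ (X : List A) (L : List I) (hit : A → I → ℕ) (δ : I → I → ℕ) q κ →
    (∀ i → i ∈ L → q * (∑[ x ← X ] hit x i) ≡ length X) →
    (∀ i j → i ∈ L → j ∈ L →
      q * (q * (∑[ x ← X ] hit x i * hit x j)) ≤ length X + δ i j * (q * length X)) →
    (∀ i → i ∈ L → ∑[ j ← L ] δ i j ≤ κ) →
    ∀ {E} → Unique E → (∀ {x} → x ∈ E → x ∈ X) → ∀ t →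
    2 * t * q * (∑[ x ← E ] ∑[ i ← L ] hit x i)
      ≤ length E * (2 * t * length L + t * t) + κ * length L * (q * length X)
  incidence-bound {A = A} X L hit δ q κ first second collisions {E} uE E⊆X t = begin
    2 * t * q * ∑ E N                                  ≡⟨ *-assoc (2 * t) q (∑ E N) ⟩
    2 * t * (q * ∑ E N)                                ≡⟨ cong (2 * t *_) (∑-*ˡ E q N) ⟨
    2 * t * (∑[ x ← E ] q * N x)                       ≡⟨ ∑-*ˡ E (2 * t) (λ x → q * N x) ⟨
    (∑[ x ← E ] 2 * t * (q * N x))                     ≤⟨ ∑-mono E (λ x _ → 2ta≤2tm+t²+∣a-m∣² t (q * N x) m) ⟩
    (∑[ x ← E ] ((2 * t * m + t * t) + dev x))         ≡⟨ ∑-+ E (λ _ → 2 * t * m + t * t) dev ⟩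
    (∑[ x ← E ] (2 * t * m + t * t)) + ∑ E dev         ≡⟨ cong (_+ ∑ E dev) (∑-const E _) ⟩
    length E * (2 * t * m + t * t) + ∑ E dev           ≤⟨ +-monoʳ-≤ (length E * (2 * t * m + t * t)) (∑-⊆ dev uE E⊆X) ⟩
    length E * (2 * t * m + t * t) + ∑ X dev           ≤⟨ +-monoʳ-≤ (length E * (2 * t * m + t * t)) variance ⟩
    length E * (2 * t * m + t * t) + κ * m * (q * H)   ∎
    where
    open ≤-Reasoning
    m = length L
    H = length X
    N : A → ℕ
    N x = ∑[ i ← L ] hit x i
    dev : A → ℕ
    dev x = ∣ q * N x - m ∣ * ∣ q * N x - m ∣

    mean : q * ∑ X N ≡ m * H
    mean = trans (cong (q *_) (∑-swap X L hit))
      (trans (sym (∑-*ˡ L q λ i → ∑[ x ← X ] hit x i)) (trans (∑-cong L first) (∑-const L H)))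

    -- Each pair (i, j) is charged `H`, as if the two events were independent of probability 1/q;
    -- the excess in a row i adds up to at most `κ * (q * H)` by `collisions`.
    square : q * (q * (∑[ x ← X ] N x * N x)) ≤ m * (m * H) + κ * m * (q * H)
    square = begin
      q * (q * (∑[ x ← X ] N x * N x))
        ≡⟨ cong (λ z → q * (q * z)) (trans (∑-cong X λ x _ → ∑-square L (hit x)) (trans (∑-swap X L _) (∑-cong L λ i _ → ∑-swap X L _))) ⟩
      q * (q * (∑[ i ← L ] ∑[ j ← L ] ∑[ x ← X ] hit x i * hit x j))
        ≡⟨ cong (q *_) (∑-*ˡ L q _) ⟨
      q * (∑[ i ← L ] q * (∑[ j ← L ] ∑[ x ← X ] hit x i * hit x j))
        ≡⟨ ∑-*ˡ L q _ ⟨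
      (∑[ i ← L ] q * (q * (∑[ j ← L ] ∑[ x ← X ] hit x i * hit x j)))
        ≤⟨ ∑-mono L row ⟩
      (∑[ i ← L ] (m * H + κ * (q * H)))
        ≡⟨ ∑-const L _ ⟩
      m * (m * H + κ * (q * H))
        ≡⟨ rearrange m H κ (q * H) ⟩
      m * (m * H) + κ * m * (q * H) ∎
      where
      rearrange : ∀ m H k z → m * (m * H + k * z) ≡ m * (m * H) + k * m * z
      rearrange = solve-∀
      row : ∀ i → i ∈ L → q * (q * (∑[ j ← L ] ∑[ x ← X ] hit x i * hit x j)) ≤ m * H + κ * (q * H)
      row i i∈ = begin
        q * (q * (∑[ j ← L ] ∑[ x ← X ] hit x i * hit x j))
          ≡⟨ trans (∑-*ˡ L q _) (cong (q *_) (∑-*ˡ L q _)) ⟨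
        (∑[ j ← L ] q * (q * (∑[ x ← X ] hit x i * hit x j)))
          ≤⟨ ∑-mono L (λ j → second i j i∈) ⟩
        (∑[ j ← L ] (H + δ i j * (q * H)))
          ≡⟨ ∑-+ L (λ _ → H) (λ j → δ i j * (q * H)) ⟩
        (∑[ j ← L ] H) + (∑[ j ← L ] δ i j * (q * H))
          ≡⟨ cong₂ _+_ (∑-const L H) (∑-*ʳ L (q * H) (δ i)) ⟩
        m * H + ∑ L (δ i) * (q * H)
          ≤⟨ +-monoʳ-≤ (m * H) (*-monoˡ-≤ (q * H) (collisions i i∈)) ⟩
        m * H + κ * (q * H) ∎

    variance : ∑ X dev ≤ κ * m * (q * H)
    -- The cross term of the expanded square, 2m²H by `mean`, is added to both sides in place of a
    -- subtraction. The two copies of m²H, from the second moment and from the constant term, then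
    -- cancel against it.
    variance = +-cancelʳ-≤ (2 * (m * (m * H))) _ _ (begin
      ∑ X dev + 2 * (m * (m * H))
        ≡⟨ cong (λ z → ∑ X dev + 2 * (m * z)) mean ⟨
      ∑ X dev + 2 * (m * (q * ∑ X N))
        ≡⟨ cong (∑ X dev +_) (reassoc m q (∑ X N)) ⟩
      ∑ X dev + 2 * m * q * ∑ X N
        ≡⟨ cong (∑ X dev +_) (∑-*ˡ X (2 * m * q) N) ⟨
      ∑ X dev + (∑[ x ← X ] 2 * m * q * N x)
        ≡⟨ ∑-+ X dev _ ⟨
      (∑[ x ← X ] (dev x + 2 * m * q * N x))
        ≡⟨ ∑-cong X (λ x _ → trans (cong (dev x +_) (shuffle m q (N x))) (∣-∣²+2ab≡a²+b² (q * N x) m)) ⟩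
      (∑[ x ← X ] (q * N x * (q * N x) + m * m))
        ≡⟨ ∑-+ X _ _ ⟩
      (∑[ x ← X ] q * N x * (q * N x)) + (∑[ x ← X ] m * m)
        ≡⟨ cong₂ _+_ (trans (∑-cong X λ x _ → regroup q (N x)) (∑-*ˡ X (q * q) _)) (∑-const X (m * m)) ⟩
      q * q * (∑[ x ← X ] N x * N x) + H * (m * m)
        ≡⟨ cong₂ _+_ (*-assoc q q (∑[ x ← X ] N x * N x)) (last m H) ⟩
      q * (q * (∑[ x ← X ] N x * N x)) + m * (m * H)
        ≤⟨ +-monoˡ-≤ (m * (m * H)) square ⟩
      m * (m * H) + κ * m * (q * H) + m * (m * H)
        ≡⟨ final (m * (m * H)) (κ * m * (q * H)) ⟩
      κ * m * (q * H) + 2 * (m * (m * H)) ∎)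
      where
      reassoc : ∀ m q n → 2 * (m * (q * n)) ≡ 2 * m * q * n
      reassoc = solve-∀
      shuffle : ∀ m q n → 2 * m * q * n ≡ 2 * (q * n * m)
      shuffle = solve-∀
      regroup : ∀ q n → q * n * (q * n) ≡ q * q * (n * n)
      regroup = solve-∀
      last : ∀ m H → H * (m * m) ≡ m * (m * H)
      last = solve-∀
      final : ∀ a b → a + b + a ≡ b + 2 * a
      final = solve-∀

-- Vectors and the dot product over a finite field.

module LinearAlgebra (𝔽 : FiniteField) where

  open Sums
  open SecondMoment
  open import Level using (0ℓ)
  open import Data.Nat as ℕ using (ℕ; zero; suc; _^_)
  import Data.Nat.Properties as ℕ
  open import Data.Product using (∃; _×_; _,_; proj₁; proj₂)
  open import Data.Sum using (_⊎_; inj₁; inj₂)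
  open import Data.Empty using (⊥-elim)
  open import Data.List as List using (List; []; _∷_; length)
  open import Data.List.Membership.Propositional using (_∈_)
  open import Data.List.Membership.Propositional.Properties using (∈-cartesianProductWith⁺)
  open import Data.List.Relation.Unary.Any using (here)
  open import Data.List.Relation.Unary.All using ([])
  open import Data.List.Relation.Unary.AllPairs using ([]; _∷_)
  open import Data.List.Relation.Unary.Unique.Propositional using (Unique)
  open import Data.List.Relation.Unary.Unique.Propositional.Properties using (cartesianProductWith⁺)
  open import Data.Vec using (Vec; []; _∷_; map; zipWith; replicate)
  open import Data.Vec.Properties using (∷-injective)
  open import Algebra.Bundles using (CommutativeRing)
  open import Relation.Nullary using (yes; no)
  open import Relation.Binary.PropositionalEquality

  open FiniteField 𝔽 public

  commutativeRing : CommutativeRing 0ℓ 0ℓ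
  commutativeRing = record { isCommutativeRing = isCommutativeRing }

  open CommutativeRing commutativeRing public
    using (+-comm; +-assoc; +-identityˡ; +-identityʳ; -‿inverseʳ; *-comm; *-assoc; *-identityˡ; *-identityʳ;
           distribˡ; distribʳ; zeroˡ; zeroʳ; ring; +-group; commutativeSemiring)
  open import Algebra.Properties.Ring ring public
    using (-‿distribˡ-*)
  open import Algebra.Properties.Group +-group public
    using ()
    renaming (x∙y⁻¹≈ε⇒x≈y to x-y≡0⇒x≡y; inverseˡ-unique to -‿uniqueˡ; ⁻¹-involutive to -‿involutive;
              //-rightDividesˡ to [x-y]+y≡x; //-rightDividesʳ to [x+y]-y≡x; ε⁻¹≈ε to -0≡0)
  open import Algebra.Solver.Ring.NaturalCoefficients.Default commutativeSemiring public
    using (solve; _:+_; _:*_; _:=_; con)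

  private variable
    D : ℕ

  inverseʳ : ∀ {x} → x ≢ 0# → x ⁻¹ * x ≡ 1#
  inverseʳ {x} x≢0 = trans (*-comm (x ⁻¹) x) (⁻¹-inverse x x≢0)

  *-cancelˡ : ∀ {x y z} → x ≢ 0# → x * y ≡ x * z → y ≡ z
  *-cancelˡ {x} {y} {z} x≢0 e = begin
    y                ≡⟨ *-identityˡ y ⟨
    1# * y           ≡⟨ cong (_* y) (inverseʳ x≢0) ⟨
    x ⁻¹ * x * y     ≡⟨ *-assoc (x ⁻¹) x y ⟩
    x ⁻¹ * (x * y)   ≡⟨ cong (x ⁻¹ *_) e ⟩
    x ⁻¹ * (x * z)   ≡⟨ *-assoc (x ⁻¹) x z ⟨
    x ⁻¹ * x * z     ≡⟨ cong (_* z) (inverseʳ x≢0) ⟩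
    1# * z           ≡⟨ *-identityˡ z ⟩
    z                ∎
    where open ≡-Reasoning

  integral : ∀ {x y} → x ≢ 0# → x * y ≡ 0# → y ≡ 0#
  integral {x} x≢0 e = *-cancelˡ x≢0 (trans e (sym (zeroʳ x)))

  *-nonzero : ∀ {x y} → x ≢ 0# → y ≢ 0# → x * y ≢ 0#
  *-nonzero x≢0 y≢0 e = y≢0 (integral x≢0 e)

  square-injective : ∀ {x y} → x * x ≡ y * y → x ≡ y ⊎ x ≡ - y
  square-injective {x} {y} e with (x - y) ≟ 0#
  ... | yes x-y≡0 = inj₁ (x-y≡0⇒x≡y x y x-y≡0)
  ... | no  x-y≢0 = inj₂ (-‿uniqueˡ x y (integral x-y≢0 (begin
    (x - y) * (x + y)                    ≡⟨ distribʳ (x + y) x (- y) ⟩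
    x * (x + y) + - y * (x + y)          ≡⟨ cong₂ _+_ (distribˡ x x y) (sym (-‿distribˡ-* y (x + y))) ⟩
    (x * x + x * y) - y * (x + y)        ≡⟨ cong (λ z → x * x + x * y - z) (trans (distribˡ y x y) (trans (+-comm (y * x) (y * y)) (cong₂ _+_ (sym e) (*-comm y x)))) ⟩
    (x * x + x * y) - (x * x + x * y)    ≡⟨ -‿inverseʳ (x * x + x * y) ⟩
    0#                                   ∎)))
    where open ≡-Reasoning

  -- Kept generic in the alphabet: over `elements` it enumerates the points of the space, over
  -- `space d` the matrices, given by their rows.
  vectors : ∀ {A : Set} → List A → ∀ n → List (Vec A n)
  vectors xs zero    = [] ∷ []
  vectors xs (suc n) = List.cartesianProductWith _∷_ xs (vectors xs n)

  vectors-complete : ∀ {A : Set} {xs : List A} → (∀ x → x ∈ xs) → ∀ {n} (v : Vec A n) → v ∈ vectors xs n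
  vectors-complete all []      = here refl
  vectors-complete all (x ∷ v) = ∈-cartesianProductWith⁺ _∷_ (all x) (vectors-complete all v)

  vectors-unique : ∀ {A : Set} {xs : List A} → Unique xs → ∀ n → Unique (vectors xs n)
  vectors-unique u zero    = [] ∷ []
  vectors-unique u (suc n) = cartesianProductWith⁺ _∷_ ∷-injective u (vectors-unique u n)

  length-vectors : ∀ {A : Set} (xs : List A) n → length (vectors xs n) ≡ length xs ^ n
  length-vectors xs zero    = refl
  length-vectors xs (suc n) = begin
    length (vectors xs (suc n))                   ≡⟨ length-∑ (vectors xs (suc n)) ⟩
    ∑ (vectors xs (suc n)) (λ _ → 1)              ≡⟨ ∑-cartesianProductWith _∷_ xs (vectors xs n) _ ⟩
    (∑[ x ← xs ] ∑[ v ← vectors xs n ] 1)         ≡⟨ ∑-const xs _ ⟩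
    length xs ℕ.* ∑ (vectors xs n) (λ _ → 1)      ≡⟨ cong (length xs ℕ.*_) (trans (sym (length-∑ (vectors xs n))) (length-vectors xs n)) ⟩
    length xs ^ suc n                             ∎
    where open ≡-Reasoning

  space : ∀ D → List (Point D)
  space = vectors elements

  space-complete : (x : Point D) → x ∈ space D
  space-complete = vectors-complete elements-complete

  space-unique : ∀ D → Unique (space D)
  space-unique = vectors-unique elements-unique

  length-space : ∀ D → length (space D) ≡ order ^ D
  length-space = length-vectors elements

  add : Point D → Point D → Point D
  add = zipWith _+_

  scale : F → Point D → Point D
  scale c = map (c *_)

  origin : Point D
  origin = replicate _ 0#

  dot-comm : (u v : Point D) → dot u v ≡ dot v u
  dot-comm []      []      = refl
  dot-comm (x ∷ u) (y ∷ v) = cong₂ _+_ (*-comm x y) (dot-comm u v)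

  dot-addˡ : (u v w : Point D) → dot (add u v) w ≡ dot u w + dot v w
  dot-addˡ []      []      []      = sym (+-identityˡ 0#)
  dot-addˡ (x ∷ u) (y ∷ v) (z ∷ w) = trans (cong ((x + y) * z +_) (dot-addˡ u v w))
    (solve 5 (λ x y z a b → (x :+ y) :* z :+ (a :+ b) := (x :* z :+ a) :+ (y :* z :+ b)) refl
      x y z (dot u w) (dot v w))

  dot-scaleˡ : ∀ c (u v : Point D) → dot (scale c u) v ≡ c * dot u v
  dot-scaleˡ c []      []      = sym (zeroʳ c)
  dot-scaleˡ c (x ∷ u) (y ∷ v) = trans (cong (c * x * y +_) (dot-scaleˡ c u v))
    (solve 4 (λ c x y a → c :* x :* y :+ c :* a := c :* (x :* y :+ a)) refl c x y (dot u v))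

  dot-scaleʳ : ∀ c (u v : Point D) → dot u (scale c v) ≡ c * dot u v
  dot-scaleʳ c u v = trans (dot-comm u (scale c v)) (trans (dot-scaleˡ c v u) (cong (c *_) (dot-comm v u)))

  dot-originˡ : (v : Point D) → dot origin v ≡ 0#
  dot-originˡ []      = refl
  dot-originˡ (x ∷ v) = trans (cong₂ _+_ (zeroˡ x) (dot-originˡ v)) (+-identityˡ 0#)

  add-sub : (u v : Point D) → add (sub u v) v ≡ u
  add-sub []      []      = refl
  add-sub (x ∷ u) (y ∷ v) = cong₂ _∷_ ([x-y]+y≡x y x) (add-sub u v)

  sub-add : (u v : Point D) → sub (add u v) v ≡ u
  sub-add []      []      = refl
  sub-add (x ∷ u) (y ∷ v) = cong₂ _∷_ ([x+y]-y≡x y x) (sub-add u v)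

  dot-subˡ : (u v w : Point D) → dot (sub u v) w ≡ dot u w - dot v w
  dot-subˡ u v w = begin
    dot (sub u v) w                        ≡⟨ [x+y]-y≡x (dot v w) (dot (sub u v) w) ⟨
    (dot (sub u v) w + dot v w) - dot v w  ≡⟨ cong (_- dot v w) (dot-addˡ (sub u v) v w) ⟨
    dot (add (sub u v) v) w - dot v w      ≡⟨ cong (λ z → dot z w - dot v w) (add-sub u v) ⟩
    dot u w - dot v w                      ∎
    where open ≡-Reasoning

  dot-subʳ : (u v w : Point D) → dot w (sub u v) ≡ dot w u - dot w v
  dot-subʳ u v w = trans (dot-comm w (sub u v)) (trans (dot-subˡ u v w) (cong₂ _-_ (dot-comm u w) (dot-comm v w)))

  sub≡origin⇒≡ : (u v : Point D) → sub u v ≡ origin → u ≡ v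
  sub≡origin⇒≡ []      []      e = refl
  sub≡origin⇒≡ (x ∷ u) (y ∷ v) e with ∷-injective e
  ... | e₁ , e₂ = cong₂ _∷_ (x-y≡0⇒x≡y x y e₁) (sub≡origin⇒≡ u v e₂)

  -- The witness is the coordinate functional at the first nonzero coordinate of `v`.
  nondegenerate : (v : Point D) → v ≢ origin → ∃ λ z → dot z v ≢ 0#
  nondegenerate []      v≢0 = ⊥-elim (v≢0 refl)
  nondegenerate (x ∷ v) v≢0 with x ≟ 0#
  ... | no  x≢0  = 1# ∷ origin , λ e → x≢0 (trans (sym (trans (cong₂ _+_ (*-identityˡ x) (dot-originˡ v)) (+-identityʳ x))) e)
  ... | yes refl with nondegenerate v (λ e → v≢0 (cong (0# ∷_) e))
  ... | z , z·v≢0 = 0# ∷ z , λ e → z·v≢0 (trans (sym (trans (cong (_+ dot z v) (zeroˡ 0#)) (+-identityˡ (dot z v)))) e)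

  -- A functional killing v but not v′ is found by correcting one that separates v′ from
  -- its projection along v.
  separate : (v v′ : Point D) → v ≢ origin → (∀ c → v′ ≢ scale c v) →
             ∃ λ z → dot z v ≡ 0# × dot z v′ ≢ 0#
  separate v v′ v≢0 indep with nondegenerate v v≢0
  ... | z₀ , z₀·v≢0 = z , z·v≡0 , λ e → z₂·w≢0 (trans (sym z·v′≡) e)
    where
    open ≡-Reasoning
    z₁ = scale (dot z₀ v ⁻¹) z₀
    z₁·v≡1 : dot z₁ v ≡ 1#
    z₁·v≡1 = trans (dot-scaleˡ _ z₀ v) (inverseʳ z₀·v≢0)
    c = dot z₁ v′
    w = sub v′ (scale c v)
    sep = nondegenerate w λ e → indep c (sub≡origin⇒≡ v′ (scale c v) e)
    z₂ = proj₁ sep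
    z₂·w≢0 = proj₂ sep
    z = sub z₂ (scale (dot z₂ v) z₁)
    z·v≡0 : dot z v ≡ 0#
    z·v≡0 = begin
      dot z v                                       ≡⟨ dot-subˡ z₂ _ v ⟩
      dot z₂ v - dot (scale (dot z₂ v) z₁) v        ≡⟨ cong (λ t → dot z₂ v - t) (trans (dot-scaleˡ _ z₁ v) (trans (cong (dot z₂ v *_) z₁·v≡1) (*-identityʳ _))) ⟩
      dot z₂ v - dot z₂ v                           ≡⟨ -‿inverseʳ _ ⟩
      0#                                            ∎
    z·v′≡ : dot z v′ ≡ dot z₂ w
    z·v′≡ = begin
      dot z v′                                      ≡⟨ dot-subˡ z₂ _ v′ ⟩
      dot z₂ v′ - dot (scale (dot z₂ v) z₁) v′      ≡⟨ cong (λ t → dot z₂ v′ - t) (trans (dot-scaleˡ _ z₁ v′) (*-comm (dot z₂ v) c)) ⟩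
      dot z₂ v′ - c * dot z₂ v                      ≡⟨ cong (λ t → dot z₂ v′ - t) (dot-scaleʳ c z₂ v) ⟨
      dot z₂ v′ - dot z₂ (scale c v)                ≡⟨ dot-subʳ v′ (scale c v) z₂ ⟨
      dot z₂ w                                      ∎

-- Sizes of hyperplanes and the point-hyperplane incidence bound.

module Hyperplanes (𝔽 : FiniteField) where

  open Sums
  open SecondMoment
  open LinearAlgebra 𝔽
  open import Data.Nat as ℕ using (ℕ; suc; _≤_; _^_)
  import Data.Nat.Properties as ℕ
  open import Data.Product using (∃; _,_)
  open import Data.List as List using (List; []; _∷_; length)
  open import Data.List.Membership.Propositional using (_∈_)
  open import Data.List.Relation.Unary.Any using (any?)
  open import Data.List.Membership.Propositional using (find; lose)
  open import Data.List.Relation.Unary.Unique.Propositional using (Unique)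
  open import Data.Vec using (Vec; []; _∷_)
  open import Data.Vec.Properties using (≡-dec)
  open import Relation.Nullary using (Dec; yes; no)
  open import Relation.Binary.PropositionalEquality

  private variable
    D : ℕ
    I : Set

  _≟ᵥ_ : (u v : Point D) → Dec (u ≡ v)
  _≟ᵥ_ = ≡-dec _≟_

  ∑-translate : ∀ (s : Point D) (f : Point D → ℕ) → ∑[ x ← space D ] f (add x s) ≡ ∑ (space D) f
  ∑-translate {D} s f = ∑-bijection (λ x → add x s) (λ x → sub x s) f
    (λ x → sub-add x s) (λ x → add-sub x s) (space-unique D) space-complete

  ∑-affine : ∀ a κ t → κ ≢ 0# → ∑[ c ← elements ] 𝟙 ((a + c * κ) ≟ t) ≡ 1
  ∑-affine a κ t κ≢0 = ∑-exactly1 _ elements-unique {(t - a) * κ ⁻¹} (elements-complete _) root unique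
    where
    open ≡-Reasoning
    root : a + (t - a) * κ ⁻¹ * κ ≡ t
    root = begin
      a + (t - a) * κ ⁻¹ * κ     ≡⟨ cong (a +_) (trans (*-assoc (t - a) (κ ⁻¹) κ) (trans (cong ((t - a) *_) (inverseʳ κ≢0)) (*-identityʳ (t - a)))) ⟩
      a + (t - a)                ≡⟨ +-comm a (t - a) ⟩
      t - a + a                  ≡⟨ [x-y]+y≡x a t ⟩
      t                          ∎
    unique : ∀ {c} → a + c * κ ≡ t → c ≡ (t - a) * κ ⁻¹
    unique {c} e = *-cancelˡ κ≢0 (begin
      κ * c                      ≡⟨ *-comm κ c ⟩
      c * κ                      ≡⟨ [x+y]-y≡x a (c * κ) ⟨
      c * κ + a - a              ≡⟨ cong (_- a) (trans (+-comm (c * κ) a) (trans e (sym root))) ⟩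
      a + (t - a) * κ ⁻¹ * κ - a ≡⟨ cong (_- a) (+-comm a _) ⟩
      (t - a) * κ ⁻¹ * κ + a - a ≡⟨ [x+y]-y≡x a _ ⟩
      (t - a) * κ ⁻¹ * κ         ≡⟨ *-comm _ κ ⟩
      κ * ((t - a) * κ ⁻¹)       ∎)

  -- Averaging over the translates by multiples of z: f is unchanged, while v takes each
  -- value exactly once.
  equidistributed : ∀ (f : Point D → ℕ) z v t → dot z v ≢ 0# → (∀ c x → f (add x (scale c z)) ≡ f x) →
                    order ℕ.* (∑[ x ← space D ] f x ℕ.* 𝟙 (dot x v ≟ t)) ≡ ∑ (space D) f
  equidistributed {D} f z v t z·v≢0 invariant = begin
    order ℕ.* S
      ≡⟨ ∑-const elements S ⟨
    (∑[ c ← elements ] S)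
      ≡⟨ ∑-cong elements (λ c _ → ∑-translate (scale c z) (λ x → f x ℕ.* 𝟙 (dot x v ≟ t))) ⟨
    (∑[ c ← elements ] ∑[ x ← space D ] f (add x (scale c z)) ℕ.* 𝟙 (dot (add x (scale c z)) v ≟ t))
      ≡⟨ ∑-cong elements (λ c _ → ∑-cong (space D) λ x _ → cong₂ ℕ._*_ (invariant c x)
           (cong (λ y → 𝟙 (y ≟ t)) (trans (dot-addˡ x (scale c z) v) (cong (dot x v +_) (dot-scaleˡ c z v))))) ⟩
    (∑[ c ← elements ] ∑[ x ← space D ] f x ℕ.* 𝟙 ((dot x v + c * dot z v) ≟ t))
      ≡⟨ ∑-swap elements (space D) _ ⟩
    (∑[ x ← space D ] ∑[ c ← elements ] f x ℕ.* 𝟙 ((dot x v + c * dot z v) ≟ t))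
      ≡⟨ ∑-cong (space D) (λ x _ → trans (∑-*ˡ elements (f x) _)
           (trans (cong (f x ℕ.*_) (∑-affine (dot x v) (dot z v) t z·v≢0)) (ℕ.*-identityʳ (f x)))) ⟩
    ∑ (space D) f ∎
    where
    open ≡-Reasoning
    S = ∑[ x ← space D ] f x ℕ.* 𝟙 (dot x v ≟ t)

  hyperplane-size : ∀ (v : Point D) t → v ≢ origin →
                    order ℕ.* (∑[ x ← space D ] 𝟙 (dot x v ≟ t)) ≡ length (space D)
  hyperplane-size {D} v t v≢0 with nondegenerate v v≢0
  ... | z , z·v≢0 = trans
    (cong (order ℕ.*_) (∑-cong (space D) λ x _ → sym (ℕ.*-identityˡ (𝟙 (dot x v ≟ t)))))
    (trans (equidistributed (λ _ → 1) z v t z·v≢0 (λ _ _ → refl)) (sym (length-∑ (space D))))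

  -- Translation along a z orthogonal to `v` but not to `v′` preserves the first hyperplane while
  -- x·v′ runs through all of F. So the second condition cuts the first hyperplane down by exactly
  -- the factor q.
  two-hyperplanes-size : ∀ (v v′ : Point D) t t′ → v ≢ origin → (∀ c → v′ ≢ scale c v) →
    order ℕ.* (order ℕ.* (∑[ x ← space D ] 𝟙 (dot x v ≟ t) ℕ.* 𝟙 (dot x v′ ≟ t′))) ≡ length (space D)
  two-hyperplanes-size {D} v v′ t t′ v≢0 indep with separate v v′ v≢0 indep
  ... | z , z·v≡0 , z·v′≢0 = trans
    (cong (order ℕ.*_) (equidistributed (λ x → 𝟙 (dot x v ≟ t)) z v′ t′ z·v′≢0 λ c x → cong (λ y → 𝟙 (y ≟ t)) (begin
      dot (add x (scale c z)) v       ≡⟨ trans (dot-addˡ x (scale c z) v) (cong (dot x v +_) (dot-scaleˡ c z v)) ⟩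
      dot x v + c * dot z v           ≡⟨ cong (dot x v +_) (trans (cong (c *_) z·v≡0) (zeroʳ c)) ⟩
      dot x v + 0#                    ≡⟨ +-identityʳ (dot x v) ⟩
      dot x v                         ∎)))
    (hyperplane-size v t v≢0)
    where open ≡-Reasoning

  multiple? : (u v : Point D) → Dec (∃ λ c → v ≡ scale c u)
  multiple? u v with any? (λ c → v ≟ᵥ scale c u) elements
  ... | yes found = let c , _ , e = find found in yes (c , e)
  ... | no  none  = no λ (c , e) → none (lose (elements-complete c) e)

  -- Hyperplanes with non-parallel normals are exactly independent, so the collisions of the second
  -- moment method are the parallel pairs. For these the product of the indicators is bounded by one
  -- of them, whatever the values are; `κ` bounds how many normals are parallel to a given one.
  hyperplane-incidence : ∀ (L : List I) (normal : I → Point D) (value : I → F) κ →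
    (∀ i → i ∈ L → normal i ≢ origin) →
    (∀ i → i ∈ L → ∑[ j ← L ] 𝟙 (multiple? (normal i) (normal j)) ≤ κ) →
    ∀ {E} → Unique E → ∀ t →
    2 ℕ.* t ℕ.* order ℕ.* (∑[ x ← E ] ∑[ i ← L ] 𝟙 (dot x (normal i) ≟ value i))
      ≤ length E ℕ.* (2 ℕ.* t ℕ.* length L ℕ.+ t ℕ.* t) ℕ.+ κ ℕ.* length L ℕ.* order ^ suc D
  hyperplane-incidence {D = D} L normal value κ nonzero collisions {E} uE t =
    subst (λ H → 2 ℕ.* t ℕ.* order ℕ.* (∑[ x ← E ] ∑[ i ← L ] hit x i)
             ≤ length E ℕ.* (2 ℕ.* t ℕ.* length L ℕ.+ t ℕ.* t) ℕ.+ κ ℕ.* length L ℕ.* (order ℕ.* H))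
      (length-space D)
      (incidence-bound (space D) L hit (λ i j → 𝟙 (multiple? (normal i) (normal j))) order κ
        (λ i i∈ → hyperplane-size (normal i) (value i) (nonzero i i∈)) (λ i j i∈ _ → second i j i∈) collisions
        uE (λ {x} _ → space-complete x) t)
    where
    hit : Point D → _ → ℕ
    hit x i = 𝟙 (dot x (normal i) ≟ value i)
    second : ∀ i j → i ∈ L → order ℕ.* (order ℕ.* (∑[ x ← space D ] hit x i ℕ.* hit x j))
             ≤ length (space D) ℕ.+ 𝟙 (multiple? (normal i) (normal j)) ℕ.* (order ℕ.* length (space D))
    second i j i∈ with multiple? (normal i) (normal j)
    ... | no indep = ℕ.≤-trans (ℕ.≤-reflexive (two-hyperplanes-size (normal i) (normal j) (value i) (value j)
                       (nonzero i i∈) λ c e → indep (c , e))) (ℕ.m≤m+n _ _)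
    ... | yes _ = begin
      order ℕ.* (order ℕ.* (∑[ x ← space D ] hit x i ℕ.* hit x j))
        ≤⟨ ℕ.*-monoʳ-≤ order (ℕ.*-monoʳ-≤ order (∑-mono (space D) λ x _ →
             ℕ.≤-trans (ℕ.*-monoʳ-≤ (hit x i) (𝟙≤1 (dot x (normal j) ≟ value j))) (ℕ.≤-reflexive (ℕ.*-identityʳ (hit x i))))) ⟩
      order ℕ.* (order ℕ.* (∑[ x ← space D ] hit x i))
        ≡⟨ cong (order ℕ.*_) (hyperplane-size (normal i) (value i) (nonzero i i∈)) ⟩
      order ℕ.* length (space D)
        ≡⟨ ℕ.*-identityˡ _ ⟨
      1 ℕ.* (order ℕ.* length (space D))
        ≤⟨ ℕ.m≤n+m _ (length (space D)) ⟩
      length (space D) ℕ.+ 1 ℕ.* (order ℕ.* length (space D)) ∎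
      where open ℕ.≤-Reasoning

-- Random linear maps and the number of directions seen from the points of P.

module Directions (𝔽 : FiniteField) where

  open Sums
  open LinearAlgebra 𝔽
  open Hyperplanes 𝔽
  open import Data.Nat as ℕ using (ℕ; zero; suc; _≤_; _^_; NonZero)
  import Data.Nat.Properties as ℕ
  open import Data.Nat.Tactic.RingSolver using (solve-∀)
  open import Data.Product using (∃; _×_; _,_; proj₂)
  open import Data.List as List using (List; []; _∷_; length; filter)
  open import Data.List.Membership.Propositional using (_∈_; find; lose)
  open import Data.List.Membership.Propositional.Properties using (∈-filter⁺; ∈-filter⁻)
  open import Data.List.Relation.Unary.Any using (Any; any?)
  open import Data.List.Relation.Unary.Unique.Propositional using (Unique)
  open import Data.Vec using (Vec; []; _∷_; map)
  open import Data.Vec.Properties using (∷-injective)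
  open import Relation.Nullary using (Dec; yes; no)
  open import Relation.Nullary.Decidable using (¬?; _×-dec_)
  open import Relation.Binary.PropositionalEquality

  private variable
    d k : ℕ

  -- A fibre of `g` contains at most one point with `collides x ≡ 0`, so these are at most as many
  -- as the fibres; every other point contributes at least 1 to the sum. `collides` is left abstract
  -- to admit any upper bound for the indicator of a collision.
  pigeonhole : ∀ {A B : Set} (_≟ᴮ_ : (x y : B) → Dec (x ≡ y)) (_≟ᴬ_ : (x y : A) → Dec (x ≡ y))
    {xs : List A} {ys : List B} (g : A → B) (collides : A → ℕ) → Unique xs → (∀ y → y ∈ ys) →
    (∀ x y → x ∈ xs → y ∈ xs → x ≢ y → g x ≡ g y → 1 ≤ collides x) →
    length xs ≤ length ys ℕ.+ ∑ xs collides
  pigeonhole _≟ᴮ_ _≟ᴬ_ {xs} {ys} g collides u all h = begin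
    length xs
      ≡⟨ length-∑ xs ⟩
    (∑[ x ← xs ] 1)
      ≤⟨ ∑-mono xs (λ x _ → alone-or-collides x) ⟩
    (∑[ x ← xs ] (∑[ y ← ys ] 𝟙 (alone? y x)) ℕ.+ collides x)
      ≡⟨ ∑-+ xs _ collides ⟩
    (∑[ x ← xs ] ∑[ y ← ys ] 𝟙 (alone? y x)) ℕ.+ ∑ xs collides
      ≡⟨ cong (ℕ._+ ∑ xs collides) (∑-swap xs ys _) ⟩
    (∑[ y ← ys ] ∑[ x ← xs ] 𝟙 (alone? y x)) ℕ.+ ∑ xs collides
      ≤⟨ ℕ.+-monoˡ-≤ (∑ xs collides) (∑-mono ys λ y _ → ∑-atMost1 (alone? y) u (same y)) ⟩
    (∑[ y ← ys ] 1) ℕ.+ ∑ xs collides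
      ≡⟨ cong (ℕ._+ ∑ xs collides) (length-∑ ys) ⟨
    length ys ℕ.+ ∑ xs collides ∎
    where
    open ℕ.≤-Reasoning
    alone? : ∀ y x → Dec (g x ≡ y × collides x ≡ 0)
    alone? y x = (g x ≟ᴮ y) ×-dec (collides x ℕ.≟ 0)
    alone-or-collides : ∀ x → 1 ≤ (∑[ y ← ys ] 𝟙 (alone? y x)) ℕ.+ collides x
    alone-or-collides x with collides x in eq
    ... | suc c = ℕ.m≤n⇒m≤o+n _ (ℕ.s≤s ℕ.z≤n)
    ... | zero  = ℕ.m≤n⇒m≤n+o 0 (ℕ.≤-trans
      (ℕ.≤-reflexive (sym (𝟙-yes ((g x ≟ᴮ g x) ×-dec (0 ℕ.≟ 0)) (refl , refl))))
      (∑-∈ (λ y → 𝟙 ((g x ≟ᴮ y) ×-dec (0 ℕ.≟ 0))) (all (g x))))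
    same : ∀ y {x x′} → x ∈ xs → x′ ∈ xs → g x ≡ y × collides x ≡ 0 → g x′ ≡ y × collides x′ ≡ 0 → x ≡ x′
    same y {x} {x′} x∈ x′∈ (e , c) (e′ , _) with x ≟ᴬ x′
    ... | yes x≡x′ = x≡x′
    ... | no  x≢x′ with () ← subst (1 ≤_) c (h x x′ x∈ x′∈ x≢x′ (trans e (sym e′)))

  matrices : ∀ k d → List (Vec (Point d) k)
  matrices k d = vectors (space d) k

  apply : Vec (Point d) k → Point d → Point k
  apply A x = map (λ row → dot row x) A

  apply-sub : ∀ (A : Vec (Point d) k) x y → apply A x ≡ apply A y → apply A (sub x y) ≡ origin
  apply-sub []        x y e = refl
  apply-sub (row ∷ A) x y e with ∷-injective e
  ... | e₁ , e₂ = cong₂ _∷_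
    (trans (dot-subʳ x y row) (trans (cong (_- dot row y) e₁) (-‿inverseʳ (dot row y)))) (apply-sub A x y e₂)

  apply-scale : ∀ (A : Vec (Point d) k) c x → apply A x ≡ origin → apply A (scale c x) ≡ origin
  apply-scale []        c x e = refl
  apply-scale (row ∷ A) c x e with ∷-injective e
  ... | e₁ , e₂ = cong₂ _∷_
    (trans (dot-scaleʳ c row x) (trans (cong (c *_) e₁) (zeroʳ c))) (apply-scale A c x e₂)

  -- The rows are chosen independently, and each is orthogonal to `x` for a fraction 1/q of all
  -- choices.
  annihilators : ∀ k (x : Point d) → x ≢ origin →
                 order ^ k ℕ.* (∑[ A ← matrices k d ] 𝟙 (apply A x ≟ᵥ origin)) ≡ length (matrices k d)
  annihilators zero    x x≢0 = refl
  annihilators {d} (suc k) x x≢0 = begin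
    order ^ suc k ℕ.* (∑[ A ← matrices (suc k) d ] 𝟙 (apply A x ≟ᵥ origin))
      ≡⟨ cong (order ^ suc k ℕ.*_) (∑-cartesianProductWith _∷_ (space d) (matrices k d) _) ⟩
    order ^ suc k ℕ.* (∑[ row ← space d ] ∑[ A ← matrices k d ] 𝟙 (apply (row ∷ A) x ≟ᵥ origin))
      ≡⟨ cong (order ^ suc k ℕ.*_) (∑-cong (space d) λ row _ → trans (∑-cong (matrices k d) λ A _ → rows row A) (∑-*ˡ (matrices k d) (𝟙 (dot row x ≟ 0#)) _)) ⟩
    order ^ suc k ℕ.* (∑[ row ← space d ] 𝟙 (dot row x ≟ 0#) ℕ.* K)
      ≡⟨ cong (order ^ suc k ℕ.*_) (∑-*ʳ (space d) K _) ⟩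
    order ℕ.* order ^ k ℕ.* ((∑[ row ← space d ] 𝟙 (dot row x ≟ 0#)) ℕ.* K)
      ≡⟨ regroup order (order ^ k) (∑[ row ← space d ] 𝟙 (dot row x ≟ 0#)) K ⟩
    order ℕ.* (∑[ row ← space d ] 𝟙 (dot row x ≟ 0#)) ℕ.* (order ^ k ℕ.* K)
      ≡⟨ cong₂ ℕ._*_ (hyperplane-size x 0# x≢0) (annihilators k x x≢0) ⟩
    length (space d) ℕ.* length (matrices k d)
      ≡⟨ cong (length (space d) ℕ.*_) (length-vectors (space d) k) ⟩
    length (space d) ^ suc k
      ≡⟨ length-vectors (space d) (suc k) ⟨
    length (matrices (suc k) d) ∎
    where
    open ≡-Reasoning
    K = ∑[ A ← matrices k d ] 𝟙 (apply A x ≟ᵥ origin)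
    regroup : ∀ a b c e → a ℕ.* b ℕ.* (c ℕ.* e) ≡ a ℕ.* c ℕ.* (b ℕ.* e)
    regroup = solve-∀
    rows : ∀ row A → 𝟙 (apply (row ∷ A) x ≟ᵥ origin) ≡ 𝟙 (dot row x ≟ 0#) ℕ.* 𝟙 (apply A x ≟ᵥ origin)
    rows row A = trans
      (𝟙-cong (apply (row ∷ A) x ≟ᵥ origin) ((dot row x ≟ 0#) ×-dec (apply A x ≟ᵥ origin))
        ∷-injective λ (e , e′) → cong₂ _∷_ e e′)
      (𝟙-× (dot row x ≟ 0#) (apply A x ≟ᵥ origin))

  norm-origin : ∀ {d} → norm (origin {d}) ≡ 0#
  norm-origin {d} = dot-originˡ {d} origin

  norm-scale : ∀ c (x : Point d) → norm (scale c x) ≡ c * c * norm x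
  norm-scale c x = trans (dot-scaleˡ c x (scale c x)) (trans (cong (c *_) (dot-scaleʳ c x x)) (sym (*-assoc c c (norm x))))

  scale-injectiveˡ : ∀ {x : Point d} {c c′} → norm x ≢ 0# → scale c x ≡ scale c′ x → c ≡ c′
  scale-injectiveˡ {x = x} {c} {c′} x≢0 e = *-cancelˡ x≢0 (begin
    norm x * c            ≡⟨ *-comm (norm x) c ⟩
    c * norm x            ≡⟨ dot-scaleˡ c x x ⟨
    dot (scale c x) x     ≡⟨ cong (λ y → dot y x) e ⟩
    dot (scale c′ x) x    ≡⟨ dot-scaleˡ c′ x x ⟩
    c′ * norm x           ≡⟨ *-comm c′ (norm x) ⟩
    norm x * c′           ∎)
    where open ≡-Reasoning

  units : List F
  units = filter (λ c → ¬? (c ≟ 0#)) elements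

  order≡1+units : order ≡ suc (length units)
  order≡1+units = begin
    order
      ≡⟨ length-∑ elements ⟩
    (∑[ c ← elements ] 1)
      ≡⟨ ∑-cong elements (λ c _ → zero-or-unit c) ⟩
    (∑[ c ← elements ] 𝟙 (c ≟ 0#) ℕ.+ 𝟙 (¬? (c ≟ 0#)))
      ≡⟨ ∑-+ elements _ _ ⟩
    (∑[ c ← elements ] 𝟙 (c ≟ 0#)) ℕ.+ (∑[ c ← elements ] 𝟙 (¬? (c ≟ 0#)))
      ≡⟨ cong₂ ℕ._+_ (∑-exactly1 (_≟ 0#) elements-unique (elements-complete 0#) refl (λ e → e)) (sym (length-filter-∑ _ elements)) ⟩
    suc (length units) ∎
    where
    open ≡-Reasoning
    zero-or-unit : ∀ c → 1 ≡ 𝟙 (c ≟ 0#) ℕ.+ 𝟙 (¬? (c ≟ 0#))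
    zero-or-unit c with c ≟ 0#
    ... | yes _ = refl
    ... | no  _ = refl

  order-nonZero : NonZero order
  order-nonZero = subst NonZero (sym order≡1+units) _

  module _ (P : List (Point d)) where

    OnNonisotropicLine : Point d → Point d → Set
    OnNonisotropicLine a x = Any (λ b → norm (sub b a) ≢ 0# × ∃ λ c → x ≡ scale c (sub b a)) P

    onSphere? : ∀ a r x → Dec (OnNonisotropicLine a x × norm x ≡ r)
    onSphere? a r x =
      any? (λ b → ¬? (norm (sub b a) ≟ 0#) ×-dec multiple? (sub b a) x) P ×-dec (norm x ≟ r)

    -- The directions from a to the other points of P, each scaled to norm r.
    sphere : Point d → F → List (Point d)
    sphere a r = filter (onSphere? a r) (space d)

    -- A line of nonzero norm through the origin has `length units` nonzero points, each on exactly
    -- one sphere, so `totalDirections` is the number of pairs of a vertex and a non-isotropic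
    -- direction, times `length units`. The diagonal pairs are included in `isotropicPairs`.
    totalDirections isotropicPairs : ℕ
    totalDirections = ∑[ a ← P ] ∑[ r ← units ] length (sphere a r)
    isotropicPairs  = ∑[ a ← P ] ∑[ b ← P ] 𝟙 (norm (sub b a) ≟ 0#)

    -- The pigeonhole principle for the `order ^ k` fibres of A, summed over all matrices A. A
    -- colliding point has a difference killed by A, non-isotropic or isotropic, and each kind is
    -- converted by `annihilators`. The count is kept multiplied by the number `𝒜` of matrices,
    -- which is cancelled at the end.
    many-directions : ∀ k → Unique P →
      length units ℕ.* order ^ k ℕ.* length P ≤
      length units ℕ.* order ^ k ℕ.* order ^ k ℕ.+ (totalDirections ℕ.+ length units ℕ.* isotropicPairs)
    many-directions k uP = ℕ.*-cancelˡ-≤ 𝒜 {{𝒜-nonZero}} (begin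
      𝒜 ℕ.* (u ℕ.* Q ℕ.* m)
        ≡⟨ shuffle 𝒜 u Q m ⟩
      u ℕ.* Q ℕ.* (𝒜 ℕ.* m)
        ≤⟨ ℕ.*-monoʳ-≤ (u ℕ.* Q) summed ⟩
      u ℕ.* Q ℕ.* (𝒜 ℕ.* Q ℕ.+ ((∑[ a ← P ] ∑[ A ← M ] hits A a) ℕ.+ (∑[ a ← P ] ∑[ A ← M ] isotropicHits A a)))
        ≡⟨ expand u Q 𝒜 (∑[ a ← P ] ∑[ A ← M ] hits A a) (∑[ a ← P ] ∑[ A ← M ] isotropicHits A a) ⟩
      𝒜 ℕ.* (u ℕ.* Q ℕ.* Q) ℕ.+ (u ℕ.* Q ℕ.* (∑[ a ← P ] ∑[ A ← M ] hits A a)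
                           ℕ.+ u ℕ.* (Q ℕ.* (∑[ a ← P ] ∑[ A ← M ] isotropicHits A a)))
        ≤⟨ ℕ.+-monoʳ-≤ (𝒜 ℕ.* (u ℕ.* Q ℕ.* Q)) (ℕ.+-mono-≤ hits-bound (ℕ.*-monoʳ-≤ u isotropicHits-bound)) ⟩
      𝒜 ℕ.* (u ℕ.* Q ℕ.* Q) ℕ.+ (𝒜 ℕ.* totalDirections ℕ.+ u ℕ.* (𝒜 ℕ.* isotropicPairs))
        ≡⟨ collect 𝒜 u Q totalDirections isotropicPairs ⟩
      𝒜 ℕ.* (u ℕ.* Q ℕ.* Q ℕ.+ (totalDirections ℕ.+ u ℕ.* isotropicPairs)) ∎)
      where
      open ℕ.≤-Reasoning
      M = matrices k d
      𝒜 = length M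
      u = length units
      Q = order ^ k
      m = length P

      𝒜-nonZero : NonZero 𝒜
      𝒜-nonZero = subst NonZero (sym (trans (length-vectors (space d) k) (cong (_^ k) (length-space d))))
        (ℕ.m^n≢0 (order ^ d) k {{ℕ.m^n≢0 order d {{order-nonZero}}}})

      shuffle : ∀ a u Q m → a ℕ.* (u ℕ.* Q ℕ.* m) ≡ u ℕ.* Q ℕ.* (a ℕ.* m)
      shuffle = solve-∀
      expand : ∀ u Q a x y → u ℕ.* Q ℕ.* (a ℕ.* Q ℕ.+ (x ℕ.+ y)) ≡ a ℕ.* (u ℕ.* Q ℕ.* Q) ℕ.+ (u ℕ.* Q ℕ.* x ℕ.+ u ℕ.* (Q ℕ.* y))
      expand = solve-∀
      collect : ∀ a u Q g z → a ℕ.* (u ℕ.* Q ℕ.* Q) ℕ.+ (a ℕ.* g ℕ.+ u ℕ.* (a ℕ.* z)) ≡ a ℕ.* (u ℕ.* Q ℕ.* Q ℕ.+ (g ℕ.+ u ℕ.* z))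
      collect = solve-∀

      hit? : ∀ A a b → Dec (norm (sub b a) ≢ 0# × apply A (sub b a) ≡ origin)
      hit? A a b = ¬? (norm (sub b a) ≟ 0#) ×-dec (apply A (sub b a) ≟ᵥ origin)
      -- The case b = a is excluded since the zero difference is killed by every A, not by a
      -- fraction 1/Q of them.
      isotropic? : ∀ a b → Dec (b ≢ a × norm (sub b a) ≡ 0#)
      isotropic? a b = ¬? (b ≟ᵥ a) ×-dec (norm (sub b a) ≟ 0#)
      -- `hits` is an indicator because many points b may lie on one line through a, and all of them
      -- are killed together: the charge must go to directions. For isotropic differences the cruder
      -- count of points suffices, as they are rare.
      hits isotropicHits : Vec (Point d) k → Point d → ℕ
      hits A a = 𝟙 (any? (hit? A a) P)
      isotropicHits A a = ∑[ b ← P ] 𝟙 (isotropic? a b) ℕ.* 𝟙 (apply A (sub b a) ≟ᵥ origin)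

      collision : ∀ A a b → a ∈ P → b ∈ P → a ≢ b → apply A a ≡ apply A b → 1 ≤ hits A a ℕ.+ isotropicHits A a
      collision A a b a∈ b∈ a≢b e with norm (sub b a) ≟ 0#
      ... | no n≢0 = ℕ.m≤n⇒m≤n+o _ (ℕ.≤-reflexive
        (sym (𝟙-yes (any? (hit? A a) P) (lose b∈ (n≢0 , apply-sub A b a (sym e))))))
      ... | yes n≡0 = ℕ.m≤n⇒m≤o+n (hits A a) (ℕ.≤-trans
        (ℕ.≤-reflexive (sym (cong₂ ℕ._*_ (𝟙-yes (isotropic? a b) ((λ b≡a → a≢b (sym b≡a)) , n≡0))
                                          (𝟙-yes (apply A (sub b a) ≟ᵥ origin) (apply-sub A b a (sym e))))))
        (∑-∈ (λ b → 𝟙 (isotropic? a b) ℕ.* 𝟙 (apply A (sub b a) ≟ᵥ origin)) b∈))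

      summed : 𝒜 ℕ.* m ≤ 𝒜 ℕ.* Q ℕ.+ ((∑[ a ← P ] ∑[ A ← M ] hits A a) ℕ.+ (∑[ a ← P ] ∑[ A ← M ] isotropicHits A a))
      summed = begin
        𝒜 ℕ.* m
          ≡⟨ ∑-const M m ⟨
        (∑[ A ← M ] m)
          ≤⟨ ∑-mono M (λ A _ → pigeonhole _≟ᵥ_ _≟ᵥ_ (apply A) _ uP space-complete (collision A)) ⟩
        (∑[ A ← M ] length (space k) ℕ.+ (∑[ a ← P ] hits A a ℕ.+ isotropicHits A a))
          ≡⟨ ∑-+ M _ _ ⟩
        (∑[ A ← M ] length (space k)) ℕ.+ (∑[ A ← M ] ∑[ a ← P ] hits A a ℕ.+ isotropicHits A a)
          ≡⟨ cong₂ ℕ._+_ (trans (∑-const M _) (cong (𝒜 ℕ.*_) (length-space k)))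
               (trans (∑-swap M P _) (trans (∑-cong P λ a _ → ∑-+ M _ _) (∑-+ P _ _))) ⟩
        𝒜 ℕ.* Q ℕ.+ ((∑[ a ← P ] ∑[ A ← M ] hits A a) ℕ.+ (∑[ a ← P ] ∑[ A ← M ] isotropicHits A a)) ∎

      isotropicHits-bound : Q ℕ.* (∑[ a ← P ] ∑[ A ← M ] isotropicHits A a) ≤ 𝒜 ℕ.* isotropicPairs
      isotropicHits-bound = begin
        Q ℕ.* (∑[ a ← P ] ∑[ A ← M ] isotropicHits A a)
          ≡⟨ cong (Q ℕ.*_) (∑-cong P λ a _ → trans (∑-swap M P _) (∑-cong P λ b _ → ∑-*ˡ M (𝟙 (isotropic? a b)) _)) ⟩
        Q ℕ.* (∑[ a ← P ] ∑[ b ← P ] 𝟙 (isotropic? a b) ℕ.* (∑[ A ← M ] 𝟙 (apply A (sub b a) ≟ᵥ origin)))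
          ≡⟨ ∑-*ˡ P Q _ ⟨
        (∑[ a ← P ] Q ℕ.* (∑[ b ← P ] 𝟙 (isotropic? a b) ℕ.* (∑[ A ← M ] 𝟙 (apply A (sub b a) ≟ᵥ origin))))
          ≡⟨ ∑-cong P (λ a _ → ∑-*ˡ P Q _) ⟨
        (∑[ a ← P ] ∑[ b ← P ] Q ℕ.* (𝟙 (isotropic? a b) ℕ.* (∑[ A ← M ] 𝟙 (apply A (sub b a) ≟ᵥ origin))))
          ≤⟨ ∑-mono P (λ a _ → ∑-mono P λ b _ → pair a b) ⟩
        (∑[ a ← P ] ∑[ b ← P ] 𝒜 ℕ.* 𝟙 (norm (sub b a) ≟ 0#))
          ≡⟨ trans (∑-cong P λ a _ → ∑-*ˡ P 𝒜 _) (∑-*ˡ P 𝒜 _) ⟩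
        𝒜 ℕ.* isotropicPairs ∎
        where
        pair : ∀ a b → Q ℕ.* (𝟙 (isotropic? a b) ℕ.* (∑[ A ← M ] 𝟙 (apply A (sub b a) ≟ᵥ origin))) ≤ 𝒜 ℕ.* 𝟙 (norm (sub b a) ≟ 0#)
        pair a b with b ≟ᵥ a | norm (sub b a) ≟ 0#
        ... | yes _  | _     = ℕ.≤-trans (ℕ.≤-reflexive (ℕ.*-zeroʳ Q)) ℕ.z≤n
        ... | no _   | no _  = ℕ.≤-trans (ℕ.≤-reflexive (ℕ.*-zeroʳ Q)) ℕ.z≤n
        ... | no b≢a | yes _ = ℕ.≤-reflexive (trans (cong (Q ℕ.*_) (ℕ.*-identityˡ _))
          (trans (annihilators k (sub b a) λ e → b≢a (sub≡origin⇒≡ b a e)) (sym (ℕ.*-identityʳ 𝒜))))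

      -- As x has only one norm, the sum over r is the indicator that x lies on some sphere around
      -- a.
      scaled : Vec (Point d) k → Point d → Point d → ℕ
      scaled A a x = (∑[ r ← units ] 𝟙 (onSphere? a r x)) ℕ.* 𝟙 (apply A x ≟ᵥ origin)

      -- If A kills b − a then it kills all its multiples, which lie on the spheres around a.
      hits≤scaled : ∀ A a → u ℕ.* hits A a ≤ ∑ (space d) (scaled A a)
      hits≤scaled A a with any? (hit? A a) P
      ... | no _ = ℕ.≤-trans (ℕ.≤-reflexive (ℕ.*-zeroʳ u)) ℕ.z≤n
      ... | yes found with find found
      ... | b , b∈ , v≢0 , Av≡0 = begin
        u ℕ.* 1
          ≡⟨ ℕ.*-identityʳ u ⟩
        u
          ≡⟨ length-filter-∑ _ elements ⟩
        (∑[ c ← elements ] 𝟙 (¬? (c ≟ 0#)))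
          ≤⟨ ∑-mono elements (λ c _ → 𝟙-≤ (¬? (c ≟ 0#)) (multiple c)) ⟩
        (∑[ c ← elements ] scaled A a (scale c (sub b a)))
          ≤⟨ ∑-injection (scaled A a) (scale-injectiveˡ v≢0) elements-unique space-complete ⟩
        ∑ (space d) (scaled A a) ∎
        where
        multiple : ∀ c → c ≢ 0# → 1 ≤ scaled A a (scale c (sub b a))
        multiple c c≢0 = ℕ.*-mono-≤
          (ℕ.≤-trans (ℕ.≤-reflexive (sym (𝟙-yes (onSphere? a _ x) (lose b∈ (v≢0 , c , refl) , refl))))
            (∑-∈ (λ r → 𝟙 (onSphere? a r x)) (∈-filter⁺ _ (elements-complete (norm x)) λ e →
              *-nonzero (*-nonzero c≢0 c≢0) v≢0 (trans (sym (norm-scale c (sub b a))) e))))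
          (ℕ.≤-reflexive (sym (𝟙-yes (apply A x ≟ᵥ origin) (apply-scale A c (sub b a) Av≡0))))
          where x = scale c (sub b a)

      scaled-bound : ∀ a → Q ℕ.* (∑[ A ← M ] ∑ (space d) (scaled A a)) ≤ 𝒜 ℕ.* (∑[ r ← units ] length (sphere a r))
      scaled-bound a = begin
        Q ℕ.* (∑[ A ← M ] ∑ (space d) (scaled A a))
          ≡⟨ cong (Q ℕ.*_) (trans (∑-swap M (space d) _) (∑-cong (space d) λ x _ → ∑-*ˡ M (on x) _)) ⟩
        Q ℕ.* (∑[ x ← space d ] on x ℕ.* (∑[ A ← M ] 𝟙 (apply A x ≟ᵥ origin)))
          ≡⟨ ∑-*ˡ (space d) Q _ ⟨
        (∑[ x ← space d ] Q ℕ.* (on x ℕ.* (∑[ A ← M ] 𝟙 (apply A x ≟ᵥ origin))))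
          ≡⟨ ∑-cong (space d) (λ x _ → point x) ⟩
        (∑[ x ← space d ] 𝒜 ℕ.* on x)
          ≡⟨ ∑-*ˡ (space d) 𝒜 on ⟩
        𝒜 ℕ.* ∑ (space d) on
          ≡⟨ cong (𝒜 ℕ.*_) (trans (∑-swap (space d) units _) (∑-cong units λ r _ → sym (length-filter-∑ (onSphere? a r) (space d)))) ⟩
        𝒜 ℕ.* (∑[ r ← units ] length (sphere a r)) ∎
        where
        on : Point d → ℕ
        on x = ∑[ r ← units ] 𝟙 (onSphere? a r x)
        swap : ∀ Q o K → Q ℕ.* (o ℕ.* K) ≡ Q ℕ.* K ℕ.* o
        swap = solve-∀
        point : ∀ x → Q ℕ.* (on x ℕ.* (∑[ A ← M ] 𝟙 (apply A x ≟ᵥ origin))) ≡ 𝒜 ℕ.* on x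
        -- The origin is killed by every A, but it has norm 0 and lies on none of the spheres, so
        -- both sides vanish.
        point x with x ≟ᵥ origin
        ... | no x≢0 = trans (swap Q (on x) _) (cong (ℕ._* on x) (annihilators k x x≢0))
        ... | yes refl = trans (cong (λ o → Q ℕ.* (o ℕ.* K)) on≡0)
                               (trans (ℕ.*-zeroʳ Q) (sym (trans (cong (𝒜 ℕ.*_) on≡0) (ℕ.*-zeroʳ 𝒜))))
          where
          K = ∑[ A ← M ] 𝟙 (apply A origin ≟ᵥ origin)
          on≡0 : on origin ≡ 0
          on≡0 = trans (∑-cong units λ r r∈ → 𝟙-no (onSphere? a r origin) λ (_ , e) →
                   proj₂ (∈-filter⁻ (λ c → ¬? (c ≟ 0#)) {xs = elements} r∈) (trans (sym e) (norm-origin {d})))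
                 (∑-zero units)

      hits-bound : u ℕ.* Q ℕ.* (∑[ a ← P ] ∑[ A ← M ] hits A a) ≤ 𝒜 ℕ.* totalDirections
      hits-bound = begin
        u ℕ.* Q ℕ.* (∑[ a ← P ] ∑[ A ← M ] hits A a)
          ≡⟨ ∑-*ˡ P (u ℕ.* Q) _ ⟨
        (∑[ a ← P ] u ℕ.* Q ℕ.* (∑[ A ← M ] hits A a))
          ≡⟨ ∑-cong P (λ a _ → trans (swap u Q _) (cong (Q ℕ.*_) (sym (∑-*ˡ M u _)))) ⟩
        (∑[ a ← P ] Q ℕ.* (∑[ A ← M ] u ℕ.* hits A a))
          ≤⟨ ∑-mono P (λ a _ → ℕ.≤-trans (ℕ.*-monoʳ-≤ Q (∑-mono M λ A _ → hits≤scaled A a)) (scaled-bound a)) ⟩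
        (∑[ a ← P ] 𝒜 ℕ.* (∑[ r ← units ] length (sphere a r)))
          ≡⟨ ∑-*ˡ P 𝒜 _ ⟩
        𝒜 ℕ.* totalDirections ∎
        where
        swap : ∀ u Q x → u ℕ.* Q ℕ.* x ≡ Q ℕ.* (u ℕ.* x)
        swap = solve-∀

-- Odd characteristic and the number of isotropic pairs.

module Isotropic (𝔽 : FiniteField) where

  open Sums
  open LinearAlgebra 𝔽
  open Hyperplanes 𝔽
  open Directions 𝔽
  open import Data.Nat as ℕ using (ℕ; suc; _≤_; _^_; _%_)
  import Data.Nat.Properties as ℕ
  open import Data.Nat.DivMod using (m*n%n≡0)
  open import Data.Product using (∃; _,_)
  open import Data.Empty using (⊥)
  open import Data.List as List using (List; []; _∷_; length)
  open import Data.List.Properties using (length-map)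
  open import Data.List.Relation.Unary.Unique.Propositional using (Unique)
  open import Data.List.Relation.Unary.Unique.Propositional.Properties using (map⁺)
  open import Data.Vec using (Vec; []; _∷_)
  open import Data.Vec.Properties using (∷-injectiveˡ; ∷-injectiveʳ)
  open import Relation.Binary.PropositionalEquality

  private variable
    d : ℕ

  -- In characteristic 2 the translation x ↦ x + 1 pairs off the elements of the field.
  odd-order⇒2≢0 : order % 2 ≡ 1 → 1# + 1# ≢ 0#
  odd-order⇒2≢0 odd 1+1≡0 = not-even (∑-symmetric-even elements (λ x y → 𝟙 (y ≟ (x + 1#))) diagonal symmetric)
    where
    open ≡-Reasoning
    diagonal : ∀ x → 𝟙 (x ≟ (x + 1#)) ≡ 0
    diagonal x = 𝟙-no (x ≟ (x + 1#)) λ e → 0≢1 (begin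
      0#             ≡⟨ -‿inverseʳ x ⟨
      x - x          ≡⟨ cong (_- x) (trans e (+-comm x 1#)) ⟩
      1# + x - x     ≡⟨ [x+y]-y≡x x 1# ⟩
      1#             ∎)
    back : ∀ {x y} → y ≡ x + 1# → x ≡ y + 1#
    back {x} refl = sym (trans (+-assoc x 1# 1#) (trans (cong (x +_) 1+1≡0) (+-identityʳ x)))
    symmetric : ∀ x y → 𝟙 (y ≟ (x + 1#)) ≡ 𝟙 (x ≟ (y + 1#))
    symmetric x y = 𝟙-cong (y ≟ (x + 1#)) (x ≟ (y + 1#)) back back
    count : order ≡ ∑[ x ← elements ] ∑[ y ← elements ] 𝟙 (y ≟ (x + 1#))
    count = trans (length-∑ elements) (sym (∑-cong elements λ x _ →
      ∑-exactly1 (_≟ (x + 1#)) elements-unique (elements-complete (x + 1#)) refl (λ p → p)))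
    not-even : (∃ λ h → ∑[ x ← elements ] ∑[ y ← elements ] 𝟙 (y ≟ (x + 1#)) ≡ 2 ℕ.* h) → ⊥
    not-even (h , e) with () ← trans (sym odd)
      (trans (cong (_% 2) (trans count (trans e (ℕ.*-comm 2 h)))) (m*n%n≡0 h 2))

  scale-injectiveʳ : ∀ {c} → c ≢ 0# → ∀ (x y : Point d) → scale c x ≡ scale c y → x ≡ y
  scale-injectiveʳ c≢0 []      []      e = refl
  scale-injectiveʳ c≢0 (x ∷ u) (y ∷ v) e =
    cong₂ _∷_ (*-cancelˡ c≢0 (∷-injectiveˡ e)) (scale-injectiveʳ c≢0 u v (∷-injectiveʳ e))

  scale-1 : ∀ (x : Point d) → scale 1# x ≡ x
  scale-1 []      = refl
  scale-1 (x ∷ u) = cong₂ _∷_ (*-identityˡ x) (scale-1 u)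

  -2# : F
  -2# = - (1# + 1#)

  -- Expand ‖b - a‖ = ‖b‖ - 2 a·b + ‖a‖. The left-hand side of the conclusion is the unfolded dot
  -- product of (‖a‖, a) and (1, -2b), so that it can be read as an incidence in one dimension more.
  polarization : ∀ (a b : Point d) → norm (sub b a) ≡ 0# → norm a * 1# + dot a (scale -2# b) ≡ - norm b
  polarization a b e = -‿uniqueˡ _ (norm b) (begin
    (norm a * 1# + dot a (scale -2# b)) + norm b
      ≡⟨ cong₂ (λ x y → x + y + norm b) (*-identityʳ (norm a)) twice ⟩
    (norm a - (s + s)) + norm b
      ≡⟨ cong (norm a - (s + s) +_) (trans (sym ([x-y]+y≡x s (norm b))) (cong (_+ s) b²-s≡s-a²)) ⟩
    (norm a - (s + s)) + ((s - norm a) + s)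
      ≡⟨ solve 4 (λ a s t n → (a :+ t) :+ ((s :+ n) :+ s) := (a :+ n) :+ ((s :+ s) :+ t)) refl (norm a) s (- (s + s)) (- norm a) ⟩
    (norm a - norm a) + ((s + s) - (s + s))
      ≡⟨ cong₂ _+_ (-‿inverseʳ (norm a)) (-‿inverseʳ (s + s)) ⟩
    0# + 0#
      ≡⟨ +-identityˡ 0# ⟩
    0# ∎)
    where
    open ≡-Reasoning
    s = dot a b
    twice : dot a (scale -2# b) ≡ - (s + s)
    twice = trans (dot-scaleʳ -2# a b) (trans (sym (-‿distribˡ-* (1# + 1#) s))
      (cong (-_) (solve 1 (λ s → (con 1 :+ con 1) :* s := s :+ s) refl s)))
    b²-s≡s-a² : norm b - s ≡ s - norm a
    b²-s≡s-a² = x-y≡0⇒x≡y _ _ (begin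
      (norm b - s) - (s - norm a)            ≡⟨ cong (λ t → norm b - t - (s - norm a)) (dot-comm a b) ⟩
      (norm b - dot b a) - (s - norm a)      ≡⟨ cong₂ _-_ (dot-subʳ b a b) (dot-subʳ b a a) ⟨
      dot b (sub b a) - dot a (sub b a)      ≡⟨ dot-subˡ b a (sub b a) ⟨
      norm (sub b a)                         ≡⟨ e ⟩
      0#                                     ∎)

  -- Lifting x to (‖x‖, x) turns ‖b − a‖ = 0 into an incidence of a point with the hyperplane
  -- of normal (1, −2b).
  isotropic-bound : 1# + 1# ≢ 0# → ∀ (P : List (Point d)) → Unique P → ∀ t →
    2 ℕ.* t ℕ.* order ℕ.* isotropicPairs P
      ≤ length P ℕ.* (2 ℕ.* t ℕ.* length P ℕ.+ t ℕ.* t) ℕ.+ length P ℕ.* order ^ suc (suc d)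
  isotropic-bound {d} 2≢0 P uP t = begin
    2 ℕ.* t ℕ.* order ℕ.* isotropicPairs P
      ≤⟨ ℕ.*-monoʳ-≤ (2 ℕ.* t ℕ.* order) (∑-mono P λ a _ → ∑-mono P λ b _ →
           𝟙-mono (norm (sub b a) ≟ 0#) (dot (lift a) (normal b) ≟ (- norm b)) (polarization a b)) ⟩
    2 ℕ.* t ℕ.* order ℕ.* (∑[ a ← P ] ∑[ b ← P ] 𝟙 (dot (lift a) (normal b) ≟ (- norm b)))
      ≡⟨ cong (2 ℕ.* t ℕ.* order ℕ.*_) (∑-map lift P _) ⟨
    2 ℕ.* t ℕ.* order ℕ.* (∑[ x ← List.map lift P ] ∑[ b ← P ] 𝟙 (dot x (normal b) ≟ (- norm b)))
      -- Here `κ` is 1: the first coordinate 1 of both normals forces the factor of proportionality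
      -- to be 1, and -2 is invertible, so parallel normals come from equal points.
      ≤⟨ hyperplane-incidence P normal (λ b → - norm b) 1 (λ b _ → nonzero b) (λ b _ → collisions b)
           (map⁺ ∷-injectiveʳ uP) t ⟩
    length (List.map lift P) ℕ.* (2 ℕ.* t ℕ.* length P ℕ.+ t ℕ.* t) ℕ.+ 1 ℕ.* length P ℕ.* order ^ suc (suc d)
      ≡⟨ cong₂ (λ x y → x ℕ.* (2 ℕ.* t ℕ.* length P ℕ.+ t ℕ.* t) ℕ.+ y ℕ.* order ^ suc (suc d))
           (length-map lift P) (ℕ.*-identityˡ (length P)) ⟩
    length P ℕ.* (2 ℕ.* t ℕ.* length P ℕ.+ t ℕ.* t) ℕ.+ length P ℕ.* order ^ suc (suc d) ∎
    where
    open ℕ.≤-Reasoning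
    lift normal : Point d → Point (suc d)
    lift x = norm x ∷ x
    normal b = 1# ∷ scale -2# b
    -2≢0 : -2# ≢ 0#
    -2≢0 e = 2≢0 (trans (sym (-‿involutive (1# + 1#))) (trans (cong (-_) e) -0≡0))
    nonzero : ∀ b → normal b ≢ origin
    nonzero b e = 0≢1 (sym (∷-injectiveˡ e))
    same : ∀ a b → ∃ (λ c → normal b ≡ scale c (normal a)) → b ≡ a
    same a b (c , e) with trans (∷-injectiveˡ e) (*-identityʳ c)
    ... | refl = scale-injectiveʳ -2≢0 b a (trans (∷-injectiveʳ e) (scale-1 (scale -2# a)))
    collisions : ∀ a → ∑[ b ← P ] 𝟙 (multiple? (normal a) (normal b)) ≤ 1
    collisions a = ∑-atMost1 (λ b → multiple? (normal a) (normal b)) uP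
      λ _ _ p q → trans (same a _ p) (sym (same a _ q))

-- Dot products on one sphere and the spreads at one vertex.

module Spreads (𝔽 : FiniteField) where

  open Sums
  open LinearAlgebra 𝔽
  open Hyperplanes 𝔽
  open Directions 𝔽
  open Isotropic 𝔽
  open import Data.Nat as ℕ using (ℕ; zero; suc; _≤_; _^_; NonZero)
  import Data.Nat.Properties as ℕ
  open import Data.Nat.Tactic.RingSolver using (solve-∀)
  open import Data.Product using (∃; _×_; _,_; proj₂)
  open import Data.Sum using (_⊎_; inj₁; inj₂)
  open import Data.List as List using (List; length)
  open import Data.List.Membership.Propositional using (_∈_; find; lose)
  open import Data.List.Membership.Propositional.Properties using (∈-filter⁻)
  open import Data.List.Relation.Unary.Unique.Propositional using (Unique)
  open import Data.List.Relation.Unary.Unique.Propositional.Properties using (filter⁺)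
  open import Data.List.Relation.Unary.Any using (any?)
  open import Algebra.Properties.Group +-group using (⁻¹-injective; ∙-cancelˡ)
  open import Relation.Nullary using (yes; no)
  open import Relation.Binary.PropositionalEquality

  private variable
    d : ℕ

  fraction-≡ : ∀ {x y x′ y′} → y ≢ 0# → y′ ≢ 0# → x * y′ ≡ x′ * y → x * y ⁻¹ ≡ x′ * y′ ⁻¹
  fraction-≡ {x} {y} {x′} {y′} y≢0 y′≢0 e = *-cancelˡ (*-nonzero y≢0 y′≢0) (begin
    y * y′ * (x * y ⁻¹)
      ≡⟨ solve 4 (λ y y′ x i → y :* y′ :* (x :* i) := x :* y′ :* (y :* i)) refl y y′ x (y ⁻¹) ⟩
    x * y′ * (y * y ⁻¹)
      ≡⟨ cong₂ _*_ e (trans (⁻¹-inverse y y≢0) (sym (⁻¹-inverse y′ y′≢0))) ⟩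
    x′ * y * (y′ * y′ ⁻¹)
      ≡⟨ solve 4 (λ y y′ x i → x :* y :* (y′ :* i) := y :* y′ :* (x :* i)) refl y y′ x′ (y′ ⁻¹) ⟩
    y * y′ * (x′ * y′ ⁻¹) ∎)
    where open ≡-Reasoning

  spreadOfDot : F → F → F
  spreadOfDot r t = 1# - t * t * (r * r) ⁻¹

  -- Scaling the arms by λ₁ and λ₂ multiplies both the squared dot product and the product of the
  -- norms by λ₁²λ₂². Hence the spread only depends on the two directions, and on a sphere only on
  -- the dot product.
  spread-rescaled : ∀ {r} → r ≢ 0# → ∀ (a b c : Point d) λ₁ λ₂ →
    norm (sub b a) ≢ 0# → norm (sub c a) ≢ 0# →
    norm (scale λ₁ (sub b a)) ≡ r → norm (scale λ₂ (sub c a)) ≡ r →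
    spreadOfDot r (dot (scale λ₁ (sub b a)) (scale λ₂ (sub c a))) ≡ spreadValue b a c
  spread-rescaled {r = r} r≢0 a b c λ₁ λ₂ b≢0 c≢0 e₁ e₂ =
    cong (λ z → 1# - z) (fraction-≡ (*-nonzero r≢0 r≢0) (*-nonzero b≢0 c≢0) (begin
      t * t * (norm u * norm v)
        ≡⟨ cong (λ t → t * t * (norm u * norm v)) (trans (dot-scaleˡ λ₁ u (scale λ₂ v)) (cong (λ₁ *_) (dot-scaleʳ λ₂ u v))) ⟩
      λ₁ * (λ₂ * s) * (λ₁ * (λ₂ * s)) * (norm u * norm v)
        ≡⟨ solve 5 (λ l m s u v → l :* (m :* s) :* (l :* (m :* s)) :* (u :* v) := s :* s :* (l :* l :* u :* (m :* m :* v)))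
             refl λ₁ λ₂ s (norm u) (norm v) ⟩
      s * s * (λ₁ * λ₁ * norm u * (λ₂ * λ₂ * norm v))
        ≡⟨ cong (s * s *_) (cong₂ _*_ (trans (sym (norm-scale λ₁ u)) e₁) (trans (sym (norm-scale λ₂ v)) e₂)) ⟩
      s * s * (r * r) ∎))
    where
    open ≡-Reasoning
    u = sub b a
    v = sub c a
    s = dot u v
    t = dot (scale λ₁ u) (scale λ₂ v)

  spreadOfDot-fibre : ∀ r → r ≢ 0# → ∀ s → ∑[ t ← elements ] 𝟙 (spreadOfDot r t ≟ s) ≤ 2
  spreadOfDot-fibre r r≢0 s with any? (λ t → spreadOfDot r t ≟ s) elements
  ... | no none = ℕ.≤-trans (∑-mono elements λ t t∈ → ℕ.≤-reflexive (𝟙-no (spreadOfDot r t ≟ s) λ e → none (lose t∈ e)))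
                            (ℕ.≤-trans (ℕ.≤-reflexive (∑-zero elements)) ℕ.z≤n)
  ... | yes found with find found
  ... | t₀ , _ , refl = ∑-atMost2 _≟_ (λ t → spreadOfDot r t ≟ s) elements-unique t₀ (- t₀) λ {t} _ e →
    square-injective (*-cancelˡ w≢0 (trans (*-comm w (t * t)) (trans (⁻¹-injective (∙-cancelˡ 1# _ _ e)) (*-comm (t₀ * t₀) w))))
    where
    w = (r * r) ⁻¹
    w≢0 : w ≢ 0#
    w≢0 e = 0≢1 (trans (sym (zeroʳ (r * r))) (trans (cong (r * r *_) (sym e)) (⁻¹-inverse (r * r) (*-nonzero r≢0 r≢0))))

  module _ (P : List (Point d)) (r : F) (r≢0 : r ≢ 0#) (a : Point d) where

    private
      X = sphere P a r
      m = length X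

    ∈-sphere : ∀ {x} → x ∈ X → OnNonisotropicLine P a x × norm x ≡ r
    ∈-sphere x∈ = proj₂ (∈-filter⁻ (onSphere? P a r) {xs = space d} x∈)

    sphere-unique : Unique X
    sphere-unique = filter⁺ (onSphere? P a r) (space-unique d)

    -- Comparing norms gives c² r = r, so c = 1 or c = -1. This bounds the parallel normals in
    -- `dotCount-bound` by 2.
    sphere-parallel : ∀ {x y : Point d} → norm x ≡ r → norm y ≡ r → ∃ (λ c → y ≡ scale c x) → y ≡ x ⊎ y ≡ scale (- 1#) x
    sphere-parallel {x} nx ny (c , refl) with square-injective {c} {1#} (*-cancelˡ r≢0 (begin
      r * (c * c)           ≡⟨ *-comm r (c * c) ⟩
      c * c * r             ≡⟨ cong (c * c *_) nx ⟨
      c * c * norm x        ≡⟨ norm-scale c x ⟨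
      norm (scale c x)      ≡⟨ ny ⟩
      r                     ≡⟨ *-identityʳ r ⟨
      r * 1#                ≡⟨ cong (r *_) (*-identityˡ 1#) ⟨
      r * (1# * 1#)         ∎))
      where open ≡-Reasoning
    ... | inj₁ refl = inj₁ (scale-1 x)
    ... | inj₂ refl = inj₂ refl

    dotCount : F → ℕ
    dotCount t = ∑[ x ← X ] ∑[ y ← X ] 𝟙 (dot x y ≟ t)

    -- The sphere plays both roles: y ∈ X stands for the hyperplane of all x with x·y = t.
    dotCount-bound : ∀ t T →
      2 ℕ.* T ℕ.* order ℕ.* dotCount t ≤ m ℕ.* (2 ℕ.* T ℕ.* m ℕ.+ T ℕ.* T) ℕ.+ 2 ℕ.* m ℕ.* order ^ suc d
    dotCount-bound t T = hyperplane-incidence X (λ x → x) (λ _ → t) 2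
      (λ x x∈ e → r≢0 (trans (sym (proj₂ (∈-sphere x∈))) (trans (cong norm e) (norm-origin {d}))))
      (λ x x∈ → ∑-atMost2 _≟ᵥ_ (multiple? x) sphere-unique x (scale (- 1#) x) λ y∈ →
        sphere-parallel (proj₂ (∈-sphere x∈)) (proj₂ (∈-sphere y∈)))
      sphere-unique T

    module _ (S : List F)
      (S-complete : ∀ {b c} → b ∈ P → c ∈ P → norm (sub b a) ≢ 0# → norm (sub c a) ≢ 0# → spreadValue b a c ∈ S)
      where

      spread∈S : ∀ {x y} → x ∈ X → y ∈ X → spreadOfDot r (dot x y) ∈ S
      spread∈S x∈ y∈ with ∈-sphere x∈ | ∈-sphere y∈
      ... | onx , nx | ony , ny with find onx | find ony
      ... | b , b∈ , b≢0 , λ₁ , refl | c , c∈ , c≢0 , λ₂ , refl =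
        subst (_∈ S) (sym (spread-rescaled r≢0 a b c λ₁ λ₂ b≢0 c≢0 nx ny)) (S-complete b∈ c∈ b≢0 c≢0)

      -- A pair (x, y) is counted at t = x·y and at the spread of this t, which lies in `S`. Summing
      -- over s outside leaves at most two values of t for each s.
      pairs-by-spread : m ℕ.* m ≤ ∑[ s ← S ] ∑[ t ← elements ] 𝟙 (spreadOfDot r t ≟ s) ℕ.* dotCount t
      pairs-by-spread = begin
        m ℕ.* m
          ≡⟨ trans (∑-const X (∑[ y ← X ] 1)) (cong (m ℕ.*_) (sym (length-∑ X))) ⟨
        (∑[ x ← X ] ∑[ y ← X ] 1)
          ≤⟨ ∑-mono X (λ x x∈ → ∑-mono X λ y y∈ → classified x∈ y∈) ⟩
        (∑[ x ← X ] ∑[ y ← X ] ∑[ s ← S ] ∑[ t ← elements ] 𝟙 (spreadOfDot r t ≟ s) ℕ.* 𝟙 (dot x y ≟ t))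
          ≡⟨ trans (∑-cong X λ x _ → ∑-swap X S _) (∑-swap X S _) ⟩
        (∑[ s ← S ] ∑[ x ← X ] ∑[ y ← X ] ∑[ t ← elements ] 𝟙 (spreadOfDot r t ≟ s) ℕ.* 𝟙 (dot x y ≟ t))
          ≡⟨ ∑-cong S (λ s _ → trans (∑-cong X λ x _ → ∑-swap X elements _) (∑-swap X elements _)) ⟩
        (∑[ s ← S ] ∑[ t ← elements ] ∑[ x ← X ] ∑[ y ← X ] 𝟙 (spreadOfDot r t ≟ s) ℕ.* 𝟙 (dot x y ≟ t))
          ≡⟨ ∑-cong S (λ s _ → ∑-cong elements λ t _ →
               trans (∑-cong X λ x _ → ∑-*ˡ X (𝟙 (spreadOfDot r t ≟ s)) _) (∑-*ˡ X (𝟙 (spreadOfDot r t ≟ s)) _)) ⟩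
        (∑[ s ← S ] ∑[ t ← elements ] 𝟙 (spreadOfDot r t ≟ s) ℕ.* dotCount t) ∎
        where
        open ℕ.≤-Reasoning
        classified : ∀ {x y} → x ∈ X → y ∈ X →
          1 ≤ ∑[ s ← S ] ∑[ t ← elements ] 𝟙 (spreadOfDot r t ≟ s) ℕ.* 𝟙 (dot x y ≟ t)
        classified {x} {y} x∈ y∈ = begin
          1
            ≡⟨ cong₂ ℕ._*_ (𝟙-yes (spreadOfDot r t₀ ≟ spreadOfDot r t₀) refl) (𝟙-yes (t₀ ≟ t₀) refl) ⟨
          𝟙 (spreadOfDot r t₀ ≟ spreadOfDot r t₀) ℕ.* 𝟙 (t₀ ≟ t₀)
            ≤⟨ ∑-∈ (λ t → 𝟙 (spreadOfDot r t ≟ spreadOfDot r t₀) ℕ.* 𝟙 (t₀ ≟ t)) (elements-complete t₀) ⟩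
          (∑[ t ← elements ] 𝟙 (spreadOfDot r t ≟ spreadOfDot r t₀) ℕ.* 𝟙 (t₀ ≟ t))
            ≤⟨ ∑-∈ (λ s → ∑[ t ← elements ] 𝟙 (spreadOfDot r t ≟ s) ℕ.* 𝟙 (t₀ ≟ t)) (spread∈S x∈ y∈) ⟩
          (∑[ s ← S ] ∑[ t ← elements ] 𝟙 (spreadOfDot r t ≟ s) ℕ.* 𝟙 (t₀ ≟ t)) ∎
          where t₀ = dot x y

      -- With T = Q both error terms of `dotCount-bound` are multiples of mQ², together 3mQ². Two
      -- values of t per spread give m² · 2Qq ≤ |S| · 2mQ(2m + 3Q), and 2Qm cancels; an empty sphere
      -- is treated apart.
      sphere-bound : ∀ Q → .{{NonZero Q}} → order ^ suc d ≡ Q ℕ.* Q →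
                     order ℕ.* m ≤ length S ℕ.* (2 ℕ.* m ℕ.+ 3 ℕ.* Q)
      sphere-bound Q q^d+1≡Q² = cancel m (begin
        2 ℕ.* Q ℕ.* (order ℕ.* m ℕ.* m)
          ≡⟨ shuffle Q order m ⟩
        2 ℕ.* Q ℕ.* order ℕ.* (m ℕ.* m)
          ≤⟨ ℕ.*-monoʳ-≤ (2 ℕ.* Q ℕ.* order) pairs-by-spread ⟩
        2 ℕ.* Q ℕ.* order ℕ.* (∑[ s ← S ] ∑[ t ← elements ] 𝟙 (spreadOfDot r t ≟ s) ℕ.* dotCount t)
          ≡⟨ trans (∑-cong S λ s _ → ∑-*ˡ elements (2 ℕ.* Q ℕ.* order) _) (∑-*ˡ S (2 ℕ.* Q ℕ.* order) _) ⟨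
        (∑[ s ← S ] ∑[ t ← elements ] 2 ℕ.* Q ℕ.* order ℕ.* (𝟙 (spreadOfDot r t ≟ s) ℕ.* dotCount t))
          ≤⟨ ∑-mono S (λ s _ → ∑-mono elements λ t _ → term s t) ⟩
        (∑[ s ← S ] ∑[ t ← elements ] 𝟙 (spreadOfDot r t ≟ s) ℕ.* B)
          ≡⟨ ∑-cong S (λ s _ → ∑-*ʳ elements B _) ⟩
        (∑[ s ← S ] (∑[ t ← elements ] 𝟙 (spreadOfDot r t ≟ s)) ℕ.* B)
          ≤⟨ ∑-mono S (λ s _ → ℕ.*-monoˡ-≤ B (spreadOfDot-fibre r r≢0 s)) ⟩
        (∑[ s ← S ] 2 ℕ.* B)
          ≡⟨ ∑-const S _ ⟩
        length S ℕ.* (2 ℕ.* B)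
          ≡⟨ collect (length S) Q m ⟩
        2 ℕ.* Q ℕ.* (length S ℕ.* (2 ℕ.* m ℕ.+ 3 ℕ.* Q) ℕ.* m) ∎)
        where
        open ℕ.≤-Reasoning
        B = m ℕ.* (2 ℕ.* Q ℕ.* m ℕ.+ Q ℕ.* Q) ℕ.+ 2 ℕ.* m ℕ.* (Q ℕ.* Q)
        shuffle : ∀ Q q m → 2 ℕ.* Q ℕ.* (q ℕ.* m ℕ.* m) ≡ 2 ℕ.* Q ℕ.* q ℕ.* (m ℕ.* m)
        shuffle = solve-∀
        collect : ∀ s Q m → s ℕ.* (2 ℕ.* (m ℕ.* (2 ℕ.* Q ℕ.* m ℕ.+ Q ℕ.* Q) ℕ.+ 2 ℕ.* m ℕ.* (Q ℕ.* Q)))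
                  ≡ 2 ℕ.* Q ℕ.* (s ℕ.* (2 ℕ.* m ℕ.+ 3 ℕ.* Q) ℕ.* m)
        collect = solve-∀
        term : ∀ s t → 2 ℕ.* Q ℕ.* order ℕ.* (𝟙 (spreadOfDot r t ≟ s) ℕ.* dotCount t) ≤ 𝟙 (spreadOfDot r t ≟ s) ℕ.* B
        term s t = begin
          2 ℕ.* Q ℕ.* order ℕ.* (i ℕ.* dotCount t)     ≡⟨ move (2 ℕ.* Q ℕ.* order) i (dotCount t) ⟩
          i ℕ.* (2 ℕ.* Q ℕ.* order ℕ.* dotCount t)     ≤⟨ ℕ.*-monoʳ-≤ i (dotCount-bound t Q) ⟩
          i ℕ.* (m ℕ.* (2 ℕ.* Q ℕ.* m ℕ.+ Q ℕ.* Q) ℕ.+ 2 ℕ.* m ℕ.* order ^ suc d)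
            ≡⟨ cong (λ H → i ℕ.* (m ℕ.* (2 ℕ.* Q ℕ.* m ℕ.+ Q ℕ.* Q) ℕ.+ 2 ℕ.* m ℕ.* H)) q^d+1≡Q² ⟩
          i ℕ.* B                                      ∎
          where
          i = 𝟙 (spreadOfDot r t ≟ s)
          move : ∀ x i y → x ℕ.* (i ℕ.* y) ≡ i ℕ.* (x ℕ.* y)
          move = solve-∀
        cancel : ∀ m → 2 ℕ.* Q ℕ.* (order ℕ.* m ℕ.* m) ≤ 2 ℕ.* Q ℕ.* (length S ℕ.* (2 ℕ.* m ℕ.+ 3 ℕ.* Q) ℕ.* m) →
                 order ℕ.* m ≤ length S ℕ.* (2 ℕ.* m ℕ.+ 3 ℕ.* Q)
        cancel zero    _ = ℕ.≤-trans (ℕ.≤-reflexive (ℕ.*-zeroʳ order)) ℕ.z≤n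
        cancel (suc n) h = ℕ.*-cancelʳ-≤ _ _ (suc n) (ℕ.*-cancelˡ-≤ (2 ℕ.* Q) {{ℕ.m*n≢0 2 Q}} h)

-- Summation over vertices and norms, and the choice of the constants.

module Counting (𝔽 : FiniteField) where

  open Sums
  open FiniteField 𝔽
    using (F; Point; 0#; 1#; 0≢1; norm; sub; spreadValue; order; elements; elements-complete)
    renaming (_+_ to _+ꟳ_; -_ to -ꟳ_; _≟_ to _≟ꟳ_)
  open LinearAlgebra 𝔽 using (-‿inverseʳ) renaming (+-identityʳ to +ꟳ-identityʳ)
  open Directions 𝔽
  open Isotropic 𝔽
  open Spreads 𝔽
  open import Data.Nat
  open import Data.Nat.Properties
  open import Data.Nat.Tactic.RingSolver using (solve-∀)
  open import Data.Product using (proj₂)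
  open import Data.Empty using (⊥-elim)
  open import Data.List as List using (List; []; _∷_; length)
  open import Data.List.Membership.Propositional using (_∈_)
  open import Data.List.Membership.Propositional.Properties using (∈-filter⁻)
  open import Data.List.Relation.Unary.All using ([]; _∷_)
  open import Data.List.Relation.Unary.AllPairs using ([]; _∷_)
  open import Data.List.Relation.Unary.Unique.Propositional using (Unique)
  open import Relation.Nullary using (yes; no; ¬?)
  open import Relation.Binary.PropositionalEquality

  private
    q = order
    u = length units

  module _ (odd : q % 2 ≡ 1) {d : ℕ} (P : List (Point d)) (P-unique : Unique P)
    (k : ℕ) (q^d+1≡Q² : q ^ suc d ≡ q ^ k * q ^ k)
    (n : ℕ) .{{_ : NonZero n}} (P-large : suc n * q ^ k ≤ n * length P) (P-small : length P ≤ 2 * q ^ k)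
    (S : List F)
    (S-complete : ∀ {a b c} → a ∈ P → b ∈ P → c ∈ P →
      norm (sub b a) ≢ 0# → norm (sub c a) ≢ 0# → spreadValue b a c ∈ S)
    where

    private
      Q = q ^ k
      m = length P
      G = totalDirections P
      Z = isotropicPairs P

      instance
        q≢0 : NonZero q
        q≢0 = order-nonZero
        Q≢0 : NonZero Q
        Q≢0 = m^n≢0 q k

    -- In odd characteristic 0, 1 and -1 are distinct.
    2≤u : 2 ≤ u
    2≤u = s≤s⁻¹ (subst (3 ≤_) order≡1+units (length-⊆ {xs = 0# ∷ 1# ∷ (-ꟳ 1#) ∷ []}
      ((0≢1 ∷ 0≢-1 ∷ []) ∷ (1≢-1 ∷ []) ∷ [] ∷ []) λ _ → elements-complete _))
      where
      1≢-1 : 1# ≢ (-ꟳ 1#)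
      1≢-1 e = odd-order⇒2≢0 odd (trans (cong (1# +ꟳ_) e) (-‿inverseʳ 1#))
      0≢-1 : 0# ≢ (-ꟳ 1#)
      0≢-1 e = 0≢1 (trans (sym (-‿inverseʳ 1#)) (trans (cong (1# +ꟳ_) (sym e)) (+ꟳ-identityʳ 1#)))

    -- The parameter is taken in the form t = sQ so that a factor Q cancels. The remaining `s`
    -- balances the two error terms: s = 1 is used for the existence of a spread, s = 4n to make the
    -- isotropic pairs rare.
    isotropic-bound′ : ∀ s → 2 * s * q * Z ≤ m * (2 * s * m + s * s * Q) + m * q * Q
    isotropic-bound′ s = *-cancelˡ-≤ Q (begin
      Q * (2 * s * q * Z)                                           ≡⟨ left Q s q Z ⟩
      2 * (s * Q) * q * Z                                           ≤⟨ isotropic-bound (odd-order⇒2≢0 odd) P P-unique (s * Q) ⟩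
      m * (2 * (s * Q) * m + s * Q * (s * Q)) + m * q ^ suc (suc d) ≡⟨ cong (λ H → m * (2 * (s * Q) * m + s * Q * (s * Q)) + m * (q * H)) q^d+1≡Q² ⟩
      m * (2 * (s * Q) * m + s * Q * (s * Q)) + m * (q * (Q * Q))   ≡⟨ right m s Q q ⟩
      Q * (m * (2 * s * m + s * s * Q) + m * q * Q)                 ∎)
      where
      open ≤-Reasoning
      left : ∀ Q s q z → Q * (2 * s * q * z) ≡ 2 * (s * Q) * q * z
      left = solve-∀
      right : ∀ m s Q q → m * (2 * (s * Q) * m + s * Q * (s * Q)) + m * (q * (Q * Q)) ≡ Q * (m * (2 * s * m + s * s * Q) + m * q * Q)
      right = solve-∀

    Q<m : Q < m
    Q<m = ≰⇒> λ m≤Q → <-irrefl refl (begin-strict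
      n * m        ≤⟨ *-monoʳ-≤ n m≤Q ⟩
      n * Q        <⟨ m<n+m (n * Q) (>-nonZero⁻¹ Q) ⟩
      suc n * Q    ≤⟨ P-large ⟩
      n * m        ∎)
      where open ≤-Reasoning

    -- Otherwise every pair of points of P would be isotropic.
    spreads-nonempty : 1 ≤ length S
    spreads-nonempty = nonempty S S-complete
      where
      open ≤-Reasoning
      nonempty : ∀ S → (∀ {a b c} → a ∈ P → b ∈ P → c ∈ P →
        norm (sub b a) ≢ 0# → norm (sub c a) ≢ 0# → spreadValue b a c ∈ S) → 1 ≤ length S
      nonempty (_ ∷ _) _ = s≤s z≤n
      -- A non-isotropic b - a yields a spread already with c = b. If there is none, then Z = m²,
      -- and s = 1 gives 2um ≤ (2 + u)Q ≤ 2uQ, contrary to Q < m.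
      nonempty [] none = ⊥-elim (<⇒≱ Q<m (*-cancelˡ-≤ (2 * u) {{2u≢0}} (begin
        2 * u * m                 ≤⟨ +-cancelʳ-≤ (2 * m) (2 * u * m) (Q + q * Q) (*-cancelˡ-≤ m {{>-nonZero (≤-trans (s≤s z≤n) Q<m)}} (begin
          m * (2 * u * m + 2 * m)               ≡⟨ left m u ⟩
          2 * 1 * suc u * (m * m)               ≡⟨ cong₂ (λ q z → 2 * 1 * q * z) (sym order≡1+units) (sym all-isotropic) ⟩
          2 * 1 * q * Z                         ≤⟨ isotropic-bound′ 1 ⟩
          m * (2 * 1 * m + 1 * 1 * Q) + m * q * Q ≡⟨ right m Q q ⟩
          m * (Q + q * Q + 2 * m)               ∎)) ⟩
        Q + q * Q                 ≡⟨ cong (λ q → Q + q * Q) order≡1+units ⟩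
        Q + suc u * Q             ≡⟨⟩
        (2 + u) * Q               ≤⟨ *-monoˡ-≤ Q (+-monoˡ-≤ u 2≤u) ⟩
        (u + u) * Q               ≡⟨ double u Q ⟩
        2 * u * Q                 ∎)))
        where
        2u≢0 : NonZero (2 * u)
        2u≢0 = m*n≢0 2 u {{_}} {{>-nonZero (≤-trans (s≤s z≤n) 2≤u)}}
        left : ∀ m u → m * (2 * u * m + 2 * m) ≡ 2 * 1 * suc u * (m * m)
        left = solve-∀
        right : ∀ m Q q → m * (2 * 1 * m + 1 * 1 * Q) + m * q * Q ≡ m * (Q + q * Q + 2 * m)
        right = solve-∀
        double : ∀ u Q → (u + u) * Q ≡ 2 * u * Q
        double = solve-∀
        isotropic : ∀ {a b} → a ∈ P → b ∈ P → norm (sub b a) ≡ 0#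
        isotropic {a} {b} a∈ b∈ with norm (sub b a) ≟ꟳ 0#
        ... | yes e = e
        ... | no ≢0 with () ← none a∈ b∈ b∈ ≢0 ≢0
        all-isotropic : Z ≡ m * m
        all-isotropic = trans
          (∑-cong P λ a a∈ → trans (∑-cong P λ b b∈ → 𝟙-yes (norm (sub b a) ≟ꟳ 0#) (isotropic a∈ b∈)) (sym (length-∑ P)))
          (∑-const P m)

    summed-sphere-bound : q * G ≤ length S * (2 * G + 3 * Q * m * u)
    summed-sphere-bound = begin
      q * G
        ≡⟨ trans (∑-cong P λ a _ → ∑-*ˡ units q _) (∑-*ˡ P q _) ⟨
      (∑[ a ← P ] ∑[ r ← units ] q * length (sphere P a r))
        ≤⟨ ∑-mono P (λ a a∈ → ∑-mono units λ r r∈ → sphere-bound P r (unit≢0 r∈) a S (S-complete a∈) Q q^d+1≡Q²) ⟩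
      (∑[ a ← P ] ∑[ r ← units ] length S * (2 * length (sphere P a r) + 3 * Q))
        ≡⟨ trans (∑-cong P λ a _ → ∑-*ˡ units (length S) _) (∑-*ˡ P (length S) _) ⟩
      length S * (∑[ a ← P ] ∑[ r ← units ] (2 * length (sphere P a r) + 3 * Q))
        ≡⟨ cong (length S *_) (trans (∑-cong P λ a _ → trans (∑-+ units _ _)
             (cong₂ _+_ (∑-*ˡ units 2 _) (∑-const units (3 * Q)))) (∑-+ P _ _)) ⟩
      length S * ((∑[ a ← P ] 2 * (∑[ r ← units ] length (sphere P a r))) + (∑[ a ← P ] u * (3 * Q)))
        ≡⟨ cong (length S *_) (cong₂ _+_ (∑-*ˡ P 2 _) (trans (∑-const P _) (shuffle m u Q))) ⟩
      length S * (2 * G + 3 * Q * m * u) ∎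
      where
      open ≤-Reasoning
      shuffle : ∀ m u Q → m * (u * (3 * Q)) ≡ 3 * Q * m * u
      shuffle = solve-∀
      unit≢0 : ∀ {r} → r ∈ units → r ≢ 0#
      unit≢0 r∈ = proj₂ (∈-filter⁻ (λ c → ¬? (c ≟ꟳ 0#)) {xs = elements} r∈)

    module _ (q-large : 16 * n * suc n ≤ q) where
      open ≤-Reasoning

      -- With s = 4n and m ≤ 2Q the last term of `isotropic-bound′` is at most 2qQ², half of the
      -- target 4qQ². The other terms are at most 2Q² · 16n(n + 1), which is the origin of the
      -- threshold for q.
      few-isotropicPairs : 2 * n * Z ≤ Q * Q
      few-isotropicPairs = *-cancelˡ-≤ (4 * q) {{m*n≢0 4 q}} (begin
        4 * q * (2 * n * Z)
          ≡⟨ left q n Z ⟩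
        2 * (4 * n) * q * Z
          ≤⟨ isotropic-bound′ (4 * n) ⟩
        m * (2 * (4 * n) * m + 4 * n * (4 * n) * Q) + m * q * Q
          ≤⟨ +-mono-≤ (*-mono-≤ P-small (+-monoˡ-≤ _ (*-monoʳ-≤ (2 * (4 * n)) P-small))) (*-monoˡ-≤ Q (*-monoˡ-≤ q P-small)) ⟩
        2 * Q * (2 * (4 * n) * (2 * Q) + 4 * n * (4 * n) * Q) + 2 * Q * q * Q
          ≡⟨ regroup Q n q ⟩
        2 * (Q * Q) * (16 * n * suc n) + 2 * (Q * Q) * q
          ≤⟨ +-monoˡ-≤ _ (*-monoʳ-≤ (2 * (Q * Q)) q-large) ⟩
        2 * (Q * Q) * q + 2 * (Q * Q) * q
          ≡⟨ right Q q ⟩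
        4 * q * (Q * Q) ∎)
        where
        left : ∀ q n z → 4 * q * (2 * n * z) ≡ 2 * (4 * n) * q * z
        left = solve-∀
        regroup : ∀ Q n q → 2 * Q * (2 * (4 * n) * (2 * Q) + 4 * n * (4 * n) * Q) + 2 * Q * q * Q ≡ 2 * (Q * Q) * (16 * n * suc n) + 2 * (Q * Q) * q
        regroup = solve-∀
        right : ∀ Q q → 2 * (Q * Q) * q + 2 * (Q * Q) * q ≡ 4 * q * (Q * Q)
        right = solve-∀

      -- `P-large` says that m - Q is at least Q/n, so `many-directions` gives G + uZ ≥ uQ²/n; the
      -- isotropic pairs account for at most half of this.
      totalDirections-large : u * (Q * Q) ≤ 2 * n * G
      totalDirections-large = +-cancelʳ-≤ (u * (Q * Q) + 2 * n * (u * Q * Q)) _ _ (begin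
        u * (Q * Q) + (u * (Q * Q) + 2 * n * (u * Q * Q))
          ≡⟨ left u Q n ⟩
        2 * (u * Q * (suc n * Q))
          ≤⟨ *-monoʳ-≤ 2 (*-monoʳ-≤ (u * Q) P-large) ⟩
        2 * (u * Q * (n * m))
          ≡⟨ move u Q n m ⟩
        2 * n * (u * Q * m)
          ≤⟨ *-monoʳ-≤ (2 * n) (many-directions P k P-unique) ⟩
        2 * n * (u * Q * Q + (G + u * Z))
          ≡⟨ expand n (u * Q * Q) G u Z ⟩
        2 * n * G + (u * (2 * n * Z) + 2 * n * (u * Q * Q))
          ≤⟨ +-monoʳ-≤ (2 * n * G) (+-monoˡ-≤ _ (*-monoʳ-≤ u few-isotropicPairs)) ⟩
        2 * n * G + (u * (Q * Q) + 2 * n * (u * Q * Q)) ∎)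
        where
        left : ∀ u Q n → u * (Q * Q) + (u * (Q * Q) + 2 * n * (u * Q * Q)) ≡ 2 * (u * Q * (suc n * Q))
        left = solve-∀
        move : ∀ u Q n m → 2 * (u * Q * (n * m)) ≡ 2 * n * (u * Q * m)
        move = solve-∀
        expand : ∀ n x g u z → 2 * n * (x + (g + u * z)) ≡ 2 * n * g + (u * (2 * n * z) + 2 * n * x)
        expand = solve-∀

      spreads-large-field : q ≤ (2 + 12 * n) * length S
      spreads-large-field = *-cancelʳ-≤ _ _ G {{G≢0}} (begin
        q * G                                        ≤⟨ summed-sphere-bound ⟩
        -- The error term is at most 6uQ² because m ≤ 2Q, hence at most 12nG. It is thus absorbed in
        -- a multiple of G, which leaves the factor 2 + 12n.
        length S * (2 * G + 3 * Q * m * u)           ≤⟨ *-monoʳ-≤ (length S) (+-monoʳ-≤ (2 * G) (begin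
          3 * Q * m * u              ≤⟨ *-monoˡ-≤ u (*-monoʳ-≤ (3 * Q) P-small) ⟩
          3 * Q * (2 * Q) * u        ≡⟨ six Q u ⟩
          6 * (u * (Q * Q))          ≤⟨ *-monoʳ-≤ 6 totalDirections-large ⟩
          6 * (2 * n * G)            ∎)) ⟩
        length S * (2 * G + 6 * (2 * n * G))         ≡⟨ collect (length S) G n ⟩
        (2 + 12 * n) * length S * G                  ∎)
        where
        six : ∀ Q u → 3 * Q * (2 * Q) * u ≡ 6 * (u * (Q * Q))
        six = solve-∀
        collect : ∀ s g n → s * (2 * g + 6 * (2 * n * g)) ≡ (2 + 12 * n) * s * g
        collect = solve-∀
        G≢0 : NonZero G
        G≢0 = ≢-nonZero λ G≡0 → <⇒≱ (>-nonZero⁻¹ (u * (Q * Q))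
          {{m*n≢0 u (Q * Q) {{>-nonZero (≤-trans (s≤s z≤n) 2≤u)}} {{m*n≢0 Q Q}}}})
          (≤-trans totalDirections-large (≤-reflexive (trans (cong (2 * n *_) G≡0) (*-zeroʳ (2 * n)))))

    spreads-bound : q ≤ (16 * n * suc n + (2 + 12 * n)) * length S
    spreads-bound with 16 * n * suc n ≤? q
    ... | yes large = ≤-trans (spreads-large-field large) (*-monoˡ-≤ (length S) (m≤n+m (2 + 12 * n) (16 * n * suc n)))
    -- Below the threshold a single spread suffices, since the threshold itself is a summand of the
    -- constant.
    ... | no small = begin
      q                                                   ≤⟨ <⇒≤ (≰⇒> small) ⟩
      16 * n * suc n                                      ≤⟨ m≤m+n _ (2 + 12 * n) ⟩
      16 * n * suc n + (2 + 12 * n)                       ≡⟨ *-identityʳ _ ⟨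
      (16 * n * suc n + (2 + 12 * n)) * 1                 ≤⟨ *-monoʳ-≤ (16 * n * suc n + (2 + 12 * n)) spreads-nonempty ⟩
      (16 * n * suc n + (2 + 12 * n)) * length S          ∎
      where open ≤-Reasoning

-- Translation between rational and natural inequalities.

module Rationals where

  open import Data.Nat as ℕ using (ℕ; suc)
  import Data.Nat.Properties as ℕ
  open import Data.Integer as ℤ using (+_; +[1+_]; -[1+_])
  import Data.Integer.Properties as ℤ
  open import Data.Rational
  open import Data.Rational.Properties
  open import Data.Rational.Unnormalised as ℚᵘ using (mkℚᵘ)
  import Data.Rational.Unnormalised.Properties as ℚᵘ
  open import Relation.Binary.PropositionalEquality

  -- A positive rational is at least the reciprocal of its denominator n, so 1 + ε can be weakened
  -- to (n + 1)/n.
  clear-denominators : ∀ ε → 0ℚ < ε → ∀ Q m → (1ℚ + ε) * (+ Q / 1) ≤ + m / 1 →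
                       suc (↧ₙ ε) ℕ.* Q ℕ.≤ ↧ₙ ε ℕ.* m
  clear-denominators (mkℚ (+ 0)    _ _) (*<* (ℤ.+<+ ()))
  clear-denominators (mkℚ -[1+ _ ] _ _) (*<* ())
  clear-denominators ε@(mkℚ +[1+ p ] d _) _ Q m h = begin
    (1 ℕ.+ n) ℕ.* Q                              ≤⟨ ℕ.*-monoˡ-≤ Q (ℕ.+-monoˡ-≤ n (ℕ.s≤s (ℕ.z≤n {p}))) ⟩
    (suc p ℕ.+ n) ℕ.* Q                          ≡⟨ cong (ℕ._* Q) (trans (ℕ.+-comm (suc p) n) (cong₂ ℕ._+_ (sym (ℕ.*-identityˡ n)) (sym (ℕ.*-identityʳ (suc p))))) ⟩
    (1 ℕ.* n ℕ.+ suc p ℕ.* 1) ℕ.* Q              ≡⟨ ℕ.*-identityʳ _ ⟨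
    (1 ℕ.* n ℕ.+ suc p ℕ.* 1) ℕ.* Q ℕ.* 1        ≤⟨ ℤ.drop‿+≤+ (subst₂ ℤ._≤_ left right (ℚᵘ.drop-*≤* unnormalised)) ⟩
    m ℕ.* (1 ℕ.* n ℕ.* 1)                        ≡⟨ cong (m ℕ.*_) (trans (ℕ.*-identityʳ (1 ℕ.* n)) (ℕ.*-identityˡ n)) ⟩
    m ℕ.* n                                      ≡⟨ ℕ.*-comm m n ⟩
    n ℕ.* m                                      ∎
    where
    open ℕ.≤-Reasoning
    n = suc d
    unnormalised : (mkℚᵘ (+ 1) 0 ℚᵘ.+ mkℚᵘ +[1+ p ] d) ℚᵘ.* mkℚᵘ (+ Q) 0 ℚᵘ.≤ mkℚᵘ (+ m) 0
    unnormalised = ℚᵘ.≤-respˡ-≃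
      (ℚᵘ.≃-trans (toℚᵘ-homo-* (1ℚ + ε) (+ Q / 1)) (ℚᵘ.*-cong (toℚᵘ-homo-+ 1ℚ ε) (toℚᵘ-fromℚᵘ (mkℚᵘ (+ Q) 0))))
      (ℚᵘ.≤-respʳ-≃ (toℚᵘ-fromℚᵘ (mkℚᵘ (+ m) 0)) (toℚᵘ-mono-≤ h))
    left : (+ 1 ℤ.* + n ℤ.+ +[1+ p ] ℤ.* + 1) ℤ.* + Q ℤ.* + 1 ≡ + ((1 ℕ.* n ℕ.+ suc p ℕ.* 1) ℕ.* Q ℕ.* 1)
    left = trans (cong (λ z → z ℤ.* + Q ℤ.* + 1) (cong₂ ℤ._+_ (sym (ℤ.pos-* 1 n)) (sym (ℤ.pos-* (suc p) 1))))
      (trans (cong (ℤ._* + 1) (sym (ℤ.pos-* (1 ℕ.* n ℕ.+ suc p ℕ.* 1) Q))) (sym (ℤ.pos-* ((1 ℕ.* n ℕ.+ suc p ℕ.* 1) ℕ.* Q) 1)))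
    right : + m ℤ.* + (1 ℕ.* n ℕ.* 1) ≡ + (m ℕ.* (1 ℕ.* n ℕ.* 1))
    right = sym (ℤ.pos-* m _)

  unit-fraction-pos : ∀ C → 0ℚ < + 1 / suc C
  unit-fraction-pos C = toℚᵘ-cancel-< (ℚᵘ.<-respʳ-≃ (ℚᵘ.≃-sym (toℚᵘ-fromℚᵘ (mkℚᵘ (+ 1) C))) (ℚᵘ.*<* (ℤ.+<+ (ℕ.s≤s ℕ.z≤n))))

  unit-fraction-bound : ∀ C q N → q ℕ.≤ suc C ℕ.* N → + 1 / suc C * (+ q / 1) ≤ + N / 1
  unit-fraction-bound C q N h = toℚᵘ-cancel-≤
    (ℚᵘ.≤-respˡ-≃ (ℚᵘ.≃-sym (ℚᵘ.≃-trans (toℚᵘ-homo-* (+ 1 / suc C) (+ q / 1))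
                    (ℚᵘ.*-cong (toℚᵘ-fromℚᵘ (mkℚᵘ (+ 1) C)) (toℚᵘ-fromℚᵘ (mkℚᵘ (+ q) 0)))))
      (ℚᵘ.≤-respʳ-≃ (ℚᵘ.≃-sym (toℚᵘ-fromℚᵘ (mkℚᵘ (+ N) 0)))
        (ℚᵘ.*≤* (subst₂ ℤ._≤_ left right (ℤ.+≤+ h)))))
    where
    left : + q ≡ + 1 ℤ.* + q ℤ.* + 1
    left = sym (trans (ℤ.*-identityʳ (+ 1 ℤ.* + q)) (ℤ.*-identityˡ (+ q)))
    right : + (suc C ℕ.* N) ≡ + N ℤ.* + (suc C ℕ.* 1)
    right = trans (cong +_ (trans (ℕ.*-comm (suc C) N) (cong (N ℕ.*_) (sym (ℕ.*-identityʳ (suc C)))))) (ℤ.pos-* N _)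

-- Completeness of the list of spreads, and truncation of P.

module SpreadList (𝔽 : FiniteField) where

  open FiniteField 𝔽 using (F; Point; 0#; norm; sub; spreadValue; spreadsWithDup; numSpreads; order; _≟_)
  open Counting 𝔽 using (spreads-bound)
  open import Data.Nat hiding (_≟_)
  open import Data.Nat.Properties hiding (_≟_)
  open import Data.Nat.DivMod using (m≡m%n+[m/n]*n; %-distribˡ-+)
  open import Data.List using (List; length; take; concatMap; deduplicate)
  open import Data.List.Properties using (length-take; take++drop≡id)
  open import Data.List.Membership.Propositional using (_∈_; lose)
  open import Data.List.Membership.Propositional.Properties using (∈-++⁺ˡ; ∈-concatMap⁺; ∈-deduplicate⁺)
  open import Data.List.Relation.Unary.Any using (here)
  open import Data.List.Relation.Unary.Unique.Propositional using (Unique)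
  open import Data.List.Relation.Unary.Unique.Propositional.Properties using (take⁺)
  open import Data.Empty using (⊥-elim)
  open import Data.Product using (Σ; _,_; proj₁)
  open import Relation.Nullary using (yes; no)
  open import Relation.Binary.PropositionalEquality

  -- Gives a name to the local function of spreadsWithDup.
  entries : ∀ {d} (P : List (Point d)) →
    Σ (Point d → Point d → Point d → List F) λ entry →
      spreadsWithDup P ≡ concatMap (λ a → concatMap (λ b → concatMap (λ c → entry a b c) P) P) P
  entries P = _ , refl

  entry-spread : ∀ {d} (P : List (Point d)) a b c → norm (sub b a) ≢ 0# → norm (sub c a) ≢ 0# →
                 spreadValue b a c ∈ proj₁ (entries P) a b c
  entry-spread P a b c b≢0 c≢0 with norm (sub b a) ≟ 0# | norm (sub c a) ≟ 0#
  ... | no _    | no _    = here refl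
  ... | no _    | yes c≡0 = ⊥-elim (c≢0 c≡0)
  ... | yes b≡0 | _       = ⊥-elim (b≢0 b≡0)

  spread-listed : ∀ {d} (P : List (Point d)) {a b c} → a ∈ P → b ∈ P → c ∈ P →
    norm (sub b a) ≢ 0# → norm (sub c a) ≢ 0# → spreadValue b a c ∈ deduplicate _≟_ (spreadsWithDup P)
  spread-listed P {a} {b} {c} a∈ b∈ c∈ b≢0 c≢0 = ∈-deduplicate⁺ _≟_
    (∈-concatMap⁺ _ {xs = P} (lose a∈ (∈-concatMap⁺ _ {xs = P} (lose b∈ (∈-concatMap⁺ _ {xs = P}
      (lose c∈ (entry-spread P a b c b≢0 c≢0)))))))

  -- Here the parity of d enters: the division by 2 in the exponent is exact, so q^(d+1) is the
  -- square of Q.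
  half-exponent : ∀ d → d % 2 ≡ 1 → suc d ≡ (d + 1) / 2 + (d + 1) / 2
  half-exponent d odd = begin
    suc d                                ≡⟨ +-comm 1 d ⟩
    d + 1                                ≡⟨ m≡m%n+[m/n]*n (d + 1) 2 ⟩
    (d + 1) % 2 + (d + 1) / 2 * 2        ≡⟨ cong (_+ (d + 1) / 2 * 2) (trans (%-distribˡ-+ d 1 2) (cong (λ r → (r + 1) % 2) odd)) ⟩
    (d + 1) / 2 * 2                      ≡⟨ *-comm ((d + 1) / 2) 2 ⟩
    2 * ((d + 1) / 2)                    ≡⟨ cong ((d + 1) / 2 +_) (+-identityʳ ((d + 1) / 2)) ⟩
    (d + 1) / 2 + (d + 1) / 2            ∎
    where open ≡-Reasoning

  -- It suffices to treat a subset of at most 2 q^((d+1)/2) points.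
  numSpreads-bound : ∀ d → d % 2 ≡ 1 → order % 2 ≡ 1 → ∀ n .{{_ : NonZero n}} (P : List (Point d)) → Unique P →
    suc n * order ^ ((d + 1) / 2) ≤ n * length P →
    order ≤ (16 * n * suc n + (2 + 12 * n)) * numSpreads P
  numSpreads-bound d d-odd q-odd n P uP large =
    spreads-bound q-odd P′ (take⁺ (2 * Q) uP) k
      (trans (cong (order ^_) (half-exponent d d-odd)) (^-distribˡ-+-* order k k))
      n P′-large (≤-trans (≤-reflexive length-P′) (m⊓n≤m (2 * Q) (length P)))
      -- The list belongs to the whole of P: it contains the spreads of the truncated P′, which is
      -- all that `spreads-bound` requires.
      (deduplicate _≟_ (spreadsWithDup P))
      λ a∈ b∈ c∈ → spread-listed P (⊆P a∈) (⊆P b∈) (⊆P c∈)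
    where
    k = (d + 1) / 2
    Q = order ^ k
    P′ = take (2 * Q) P
    ⊆P : ∀ {x} → x ∈ P′ → x ∈ P
    ⊆P x∈ = subst (_ ∈_) (take++drop≡id (2 * Q) P) (∈-++⁺ˡ x∈)
    length-P′ : length P′ ≡ 2 * Q ⊓ length P
    length-P′ = length-take (2 * Q) P
    P′-large : suc n * Q ≤ n * length P′
    P′-large = begin
      -- The truncation keeps the lower bound because n ≥ 1 gives n + 1 ≤ 2n.
      suc n * Q                          ≤⟨ ⊓-glb (begin
        suc n * Q        ≤⟨ *-monoˡ-≤ Q (+-monoˡ-≤ n (>-nonZero⁻¹ n)) ⟩
        (n + n) * Q      ≡⟨ cong (λ z → (n + z) * Q) (+-identityʳ n) ⟨
        2 * n * Q        ≡⟨ cong (_* Q) (*-comm 2 n) ⟩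
        n * 2 * Q        ≡⟨ *-assoc n 2 Q ⟩
        n * (2 * Q)      ∎) large ⟩
      n * (2 * Q) ⊓ (n * length P)       ≡⟨ *-distribˡ-⊓ n (2 * Q) (length P) ⟨
      n * (2 * Q ⊓ length P)             ≡⟨ cong (n *_) length-P′ ⟨
      n * length P′                      ∎
      where open ≤-Reasoning

open import Data.Nat as ℕ using (ℕ; _%_)
open import Data.Integer using (+_)
open import Data.Rational using (ℚ; _/_; _≤_; _<_; _*_; _+_; 0ℚ; 1ℚ)
open import Data.Product using (Σ; _×_)
open import Data.List using (List; length)
open import Data.List.Relation.Unary.Unique.Propositional using (Unique)
open import Relation.Binary.PropositionalEquality using (_≡_)
open import Data.Product using (_,_)
open import Data.Rational using (↧ₙ_)

theorem1p5 : (d : ℕ) → 3 ℕ.≤ d → d % 2 ≡ 1 →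
    (ε : ℚ) → 0ℚ < ε →
    Σ ℚ λ c → 0ℚ < c ×
    ((𝔽 : FiniteField) → IsPrimePower (FiniteField.order 𝔽) → FiniteField.order 𝔽 % 2 ≡ 1 →
    (P : List (FiniteField.Point 𝔽 d)) → Unique P →
    (1ℚ + ε) * ((+ (FiniteField.order 𝔽 ℕ.^ ((d ℕ.+ 1) ℕ./ 2))) / 1) ≤ (+ length P) / 1 →
    c * ((+ FiniteField.order 𝔽) / 1) ≤ (+ FiniteField.numSpreads 𝔽 P) / 1)
theorem1p5 d _ d-odd ε 0<ε =
  + 1 / ℕ.suc C , unit-fraction-pos C , λ 𝔽 _ q-odd P uP large →
    unit-fraction-bound C (FiniteField.order 𝔽) (FiniteField.numSpreads 𝔽 P)
      (SpreadList.numSpreads-bound 𝔽 d d-odd q-odd n P uP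
        (clear-denominators ε 0<ε (FiniteField.order 𝔽 ℕ.^ ((d ℕ.+ 1) ℕ./ 2)) (length P) large))
  where
  open Rationals
  n = ↧ₙ ε
  -- The denominator n is a successor by definition, so the sum computes to a successor, and `suc C`
  -- is definitionally the factor in `numSpreads-bound`. It depends on ε only.
  C = ℕ.pred (16 ℕ.* n ℕ.* ℕ.suc n ℕ.+ (2 ℕ.+ 12 ℕ.* n))
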